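{- Let $r \geq 1$ be an integer and let $t = 1260r + 169$. Then for every integer $n \geq \frac{2119}{4}t^2 + 87978t + \frac{15957}{4}$, $$f(n) \geq n + \frac{107}{3}t + \frac{7}{3}.$$ Moreover, it is not true that $\lim_{n \to \infty} \frac{f(n) - n}{\sqrt{n}} = \sqrt{2.4}$.
   Context: For a positive integer $n$, $f(n)$ denotes the maximum number of edges in a (simple) graph on $n$ vertices in which no two cycles have the same length (i.e., all cycles in the graph have pairwise distinct lengths). -}

module Defs where

open import Data.Nat using (ℕ; zero; suc; _+_; _*_; _≤_; _<ᵇ_)
open import Data.Integer using (ℤ; +_; _-_)
open import Data.Rational as ℚ using (ℚ; _/_; 0ℚ)
open import Data.Fin using (Fin; toℕ; inject₁; fromℕ) renaming (zero to fzero; suc to fsuc)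
open import Data.Bool using (Bool; true; false; _∧_; if_then_else_)
open import Data.List using (List; map; allFin)
open import Data.Nat.ListAction using (sum)
open import Data.Product using (Σ; ∃; ∃-syntax; _×_)
open import Data.Sum using (_⊎_)
open import Relation.Binary.PropositionalEquality using (_≡_)

record SimpleGraph (n : ℕ) : Set where
  field
    adj    : Fin n → Fin n → Bool
    irrefl : ∀ i → adj i i ≡ false
    sym    : ∀ i j → adj i j ≡ adj j i

open SimpleGraph public

edgeCount : ∀ {n} → SimpleGraph n → ℕ
edgeCount {n} G =
  sum (map (λ i → sum (map (λ j → if (toℕ i <ᵇ toℕ j) ∧ adj G i j then 1 else 0)
                             (allFin n)))
           (allFin n))

record Cycle {n : ℕ} (G : SimpleGraph n) : Set where
  field
    m     : ℕ
    vs    : Fin (3 + m) → Fin n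
    inj   : ∀ i j → vs i ≡ vs j → i ≡ j
    step  : ∀ (i : Fin (2 + m)) → adj G (vs (inject₁ i)) (vs (fsuc i)) ≡ true
    close : adj G (vs (fromℕ (2 + m))) (vs fzero) ≡ true

open Cycle public

cycleLength : ∀ {n} {G : SimpleGraph n} → Cycle G → ℕ
cycleLength c = 3 + m c

UsesEdge : ∀ {n} {G : SimpleGraph n} → Cycle G → Fin n → Fin n → Set
UsesEdge c u v =
  (Σ (Fin (2 + m c)) λ i →
      (vs c (inject₁ i) ≡ u × vs c (fsuc i) ≡ v)
    ⊎ (vs c (inject₁ i) ≡ v × vs c (fsuc i) ≡ u))
  ⊎ ((vs c (fromℕ (2 + m c)) ≡ u × vs c fzero ≡ v)
    ⊎ (vs c (fromℕ (2 + m c)) ≡ v × vs c fzero ≡ u))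

SameCycle : ∀ {n} {G : SimpleGraph n} → Cycle G → Cycle G → Set
SameCycle c d = ∀ u v → (UsesEdge c u v → UsesEdge d u v) × (UsesEdge d u v → UsesEdge c u v)

DistinctCycleLengths : ∀ {n} → SimpleGraph n → Set
DistinctCycleLengths G = ∀ (c d : Cycle G) → cycleLength c ≡ cycleLength d → SameCycle c d

IsMaxEdges : ℕ → ℕ → Set
IsMaxEdges n e =
  (∃[ G ] (DistinctCycleLengths {n} G × edgeCount G ≡ e))
  × (∀ (G : SimpleGraph n) → DistinctCycleLengths G → edgeCount G ≤ e)

dev : (ℕ → ℕ) → ℕ → ℚ
dev f n = (+ f n - + n) / 1

ℕtoℚ : ℕ → ℚ
ℕtoℚ n = + n / 1

-- lim_{n→∞} (f n - n)/√n = √(12/5), stated without reals: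
-- for all rationals 0 < p < √(12/5) < q, eventually p√n < f n - n < q√n,
-- where (for p, q > 0) p√n < d ⟺ 0 ≤ d ∧ p²n < d², and d < q√n ⟺ d² < q²n (given d ≥ 0).
LimitIsSqrt12/5 : (ℕ → ℕ) → Set
LimitIsSqrt12/5 f =
  ∀ (p q : ℚ) → 0ℚ ℚ.< p → p ℚ.* p ℚ.< (+ 12 / 5) → (+ 12 / 5) ℚ.< q ℚ.* q → 0ℚ ℚ.< q →
    ∃[ N ] ∀ n → N ≤ n →
        (0ℚ ℚ.≤ dev f n)
      × (p ℚ.* p ℚ.* ℕtoℚ n ℚ.< dev f n ℚ.* dev f n)
      × (dev f n ℚ.* dev f n ℚ.< q ℚ.* q ℚ.* ℕtoℚ n)

{-# OPTIONS --safe #-}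
module Submission where

-- Let all cycles of a graph pass through one vertex, the hub, whose removal leaves
-- a forest of caterpillars.  A cycle then leaves the hub to a neighbour a and returns
-- from another neighbour b in the same tree, along the tree path from a to b: a tree
-- with k + 1 neighbours of the hub raises the excess of edges over vertices by k and
-- has only k (k + 1) / 2 cycles.  Divide the possible lengths into slots, each a
-- residue class modulo 64 within an interval of length 64 (M + 1); as m runs through
-- 0, ..., M - 1, a cycle of a tree that grows linearly with m runs through one slot.
-- It remains to choose families of trees with pairwise different slots: 86 families
-- with two to six extra edges, found by linear programming and a local search, and
-- 436 families of single cycles of the short lengths left over.  They gain 766 edges
-- for each m, at a ratio (f n - n)² / n of about 2.4022, above 107² · 4 / (9 · 2119).

-- Single cycles of all lengths up to L have about L² / 2 vertices and L extra edges, which gives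
-- only the ratio 2. The cycles of one tree share vertices, so an extra edge costs fewer of them,
-- but k extra edges use up k (k + 1) / 2 lengths. The design balances these two costs. As n is
-- unbounded, no fixed list of trees suffices. Hence all measures of a tree are linear in M and m,
-- arranged so that each of its cycles grows by exactly 64 when m grows by 1. Slot and residue then
-- do not depend on M, and one finite check of 1382 keys serves every M. With t = 1260 r + 169 the
-- claimed excess (107 t + 7) / 3 equals 44940 r + 6030, and M is the least number such that 766 M
-- exceeds it. The number of vertices has leading term 244256 M², and 766² / 244256 is the ratio
-- 2.4022. The gap to the ratio of the theorem pays for the rounding of M and the terms of lower
-- order.

open import Defs hiding (sym; step; m; vs; inj; close; adj; irrefl)
open import Data.Bool using (Bool; true; false; _∧_; if_then_else_; T)
open import Data.Empty using (⊥; ⊥-elim)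
open import Data.Fin using (Fin; toℕ; fromℕ<; inject₁; fromℕ) renaming (zero to fzero; suc to fsuc)
open import Data.Fin.Properties using (toℕ-injective; toℕ-fromℕ<; toℕ-inject₁; toℕ-fromℕ; toℕ<n)
open import Data.Integer as ℤ using () renaming (+_ to pos)
import Data.Integer.Properties as ℤ
open import Data.List using (List; []; _∷_; _++_; map; concatMap; filter; length; lookup; allFin; upTo; downFrom; cartesianProduct)
open import Data.List.Properties using (++-assoc; length-++; length-map; length-downFrom; map-++; map-∘; map-tabulate) renaming (≡-dec to List-≡-dec)
open import Data.List.Membership.Propositional using (_∈_)
open import Data.List.Membership.Propositional.Properties using (∈-lookup; ∈-++⁺ˡ; ∈-++⁺ʳ; ∈-++⁻; ∈-map⁺; ∈-map⁻; ∈-concatMap⁺; ∈-cartesianProduct⁻; ∈-upTo⁺; ∈-downFrom⁺; ∈-downFrom⁻)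
open import Data.List.Relation.Unary.All as All using (All; []; _∷_; all?)
open import Data.List.Relation.Unary.AllPairs using ([]; _∷_)
open import Data.List.Relation.Unary.Any as Any using (here; there)
open import Data.List.Relation.Unary.Unique.Propositional using (Unique)
import Data.List.Relation.Unary.Unique.Propositional.Properties as Unique
open import Data.Nat
open import Data.List.Membership.DecPropositional _≟_ using (_∈?_)
open import Data.Nat.DivMod
open import Data.Nat.Divisibility using (_∣_; n∣m*n; ∣m+n∣m⇒∣n; ∣⇒≤)
open import Data.Nat.ListAction using (sum)
open import Data.Nat.ListAction.Properties using (sum-++)
open import Data.Nat.Properties
open import Data.Nat.Tactic.RingSolver using (solve-∀)
open import Data.Product renaming (map to map×) hiding (swap)
open import Data.Product.Properties using () renaming (≡-dec to ×-≡-dec)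
open import Data.Rational as ℚ using (ℚ; 0ℚ; 1ℚ)
import Data.Rational.Properties as ℚ
open import Data.Rational.Unnormalised as ℚᵘ using (mkℚᵘ; *≤*)
import Data.Rational.Unnormalised.Properties as ℚᵘ
open import Data.Sum using (_⊎_; inj₁; inj₂; swap) renaming (map to map⊎; [_,_] to either)
open import Data.Unit using (tt)
open import Function using (_∘_)
open import Relation.Binary.Definitions using (DecidableEquality; tri<; tri≈; tri>)
open import Relation.Binary.PropositionalEquality hiding ([_])
open import Relation.Nullary
open import Relation.Nullary.Decidable using (dec-true; dec-false; from-yes; _×-dec_; _⊎-dec_; ¬?)

-- Walks

-- A cycle unrolled into a periodic sequence over `ℕ`, so that choosing another starting vertex is
-- merely a shift of the index.
record ClosedWalk {V : Set} (Adj : V → V → Set) (L : ℕ) : Set where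
  field
    at     : ℕ → V
    period : ∀ i → at (i + L) ≡ at i
    simple : ∀ i d → 0 < d → d < L → at i ≢ at (i + d)
    edge   : ∀ i → Adj (at i) (at (suc i))

open ClosedWalk public

module _ {V : Set} {Adj : V → V → Set} where

  Traverses : ∀ {L} → ClosedWalk Adj L → V → V → Set
  Traverses w x y = ∃ λ i → (at w i ≡ x × at w (suc i) ≡ y) ⊎ (at w i ≡ y × at w (suc i) ≡ x)

  rotate : ∀ {L} → ℕ → ClosedWalk Adj L → ClosedWalk Adj L
  rotate {L} s w = record
    { at     = λ i → at w (s + i)
    ; period = λ i → trans (cong (at w) (sym (+-assoc s i L))) (period w (s + i))
    ; simple = λ i d 0<d d<L e → simple w (s + i) d 0<d d<L (trans e (cong (at w) (sym (+-assoc s i d))))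
    ; edge   = λ i → subst (λ j → Adj (at w (s + i)) (at w j)) (sym (+-suc s i)) (edge w (s + i))
    }

  period* : ∀ {L} (w : ClosedWalk Adj L) i k → at w (i + k * L) ≡ at w i
  period* w i zero = cong (at w) (+-identityʳ i)
  period* {L} w i (suc k) =
    trans (cong (at w) (trans (sym (+-assoc i L (k * L))) refl))
          (trans (period* w (i + L) k) (period w i))

  rotate-traverses : ∀ {L} s (w : ClosedWalk Adj (suc L)) {x y} →
    Traverses w x y → Traverses (rotate s w) x y
  rotate-traverses {L} s w (i , e) = i + s * L , map⊎ (map× to to′) (map× to to′) e
    where
    shift : s + (i + s * L) ≡ i + s * suc L
    shift = trans (sym (+-assoc s i (s * L))) (trans (cong (_+ s * L) (+-comm s i))
             (trans (+-assoc i s (s * L)) (cong (i +_) (sym (*-suc s L)))))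
    to : ∀ {z} → at w i ≡ z → at w (s + (i + s * L)) ≡ z
    to = trans (trans (cong (at w) shift) (period* w i s))
    to′ : ∀ {z} → at w (suc i) ≡ z → at w (s + suc (i + s * L)) ≡ z
    to′ = trans (trans (cong (at w) (trans (+-suc s _) (cong suc shift))) (period* w (suc i) s))

  rotate-traverses⁻ : ∀ {L} s (w : ClosedWalk Adj L) {x y} →
    Traverses (rotate s w) x y → Traverses w x y
  rotate-traverses⁻ s w (i , e) = s + i , map⊎ (map₂ to) (map₂ to) e
    where
    to : ∀ {z} → at w (s + suc i) ≡ z → at w (suc (s + i)) ≡ z
    to = trans (cong (at w) (sym (+-suc s i)))

  at-% : ∀ {L} (w : ClosedWalk Adj (suc L)) i → at w i ≡ at w (i % suc L)
  at-% {L} w i = trans (cong (at w) (m≡m%n+[m/n]*n i (suc L))) (period* w _ (i / suc L))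

  traverses-early : ∀ {L} (w : ClosedWalk Adj (suc L)) {x y} → Traverses w x y →
    ∃ λ i → i ≤ L × ((at w i ≡ x × at w (suc i) ≡ y) ⊎ (at w i ≡ y × at w (suc i) ≡ x))
  traverses-early {L} w (i , e) = i % suc L , ≤-pred (m%n<n i (suc L)) , map⊎ (map× to to′) (map× to to′) e
    where
    k = i / suc L
    to : ∀ {z} → at w i ≡ z → at w (i % suc L) ≡ z
    to = trans (sym (at-% w i))
    to′ : ∀ {z} → at w (suc i) ≡ z → at w (suc (i % suc L)) ≡ z
    to′ = trans (sym (trans (cong (λ j → at w (suc j)) (m≡m%n+[m/n]*n i (suc L))) (period* w _ k)))

  same⇒traverses : ∀ {L} (w w′ : ClosedWalk Adj (suc L)) → (∀ i → i ≤ suc L → at w i ≡ at w′ i) →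
    ∀ {x y} → Traverses w x y → Traverses w′ x y
  same⇒traverses w w′ eq t with traverses-early w t
  ... | i , i≤L , e = i , map⊎ (map× to to′) (map× to to′) e
    where
    to : ∀ {z} → at w i ≡ z → at w′ i ≡ z
    to = trans (sym (eq i (m≤n⇒m≤1+n i≤L)))
    to′ : ∀ {z} → at w (suc i) ≡ z → at w′ (suc i) ≡ z
    to′ = trans (sym (eq (suc i) (s≤s i≤L)))

  reversed⇒traverses : ∀ {L} (w w′ : ClosedWalk Adj (suc L)) →
    (∀ i j → i + j ≡ suc L → at w i ≡ at w′ j) →
    ∀ {x y} → Traverses w x y → Traverses w′ x y
  reversed⇒traverses {L} w w′ eq t with traverses-early w t
  ... | i , i≤L , e = L ∸ i , swap (map⊎ (λ (p , q) → to′ q , to p) (λ (p , q) → to′ q , to p) e)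
    where
    split : i + (L ∸ i) ≡ L
    split = m+[n∸m]≡n i≤L
    to : ∀ {z} → at w i ≡ z → at w′ (suc (L ∸ i)) ≡ z
    to = trans (sym (eq i (suc (L ∸ i)) (trans (+-suc i _) (cong suc split))))
    to′ : ∀ {z} → at w (suc i) ≡ z → at w′ (L ∸ i) ≡ z
    to′ = trans (sym (eq (suc i) (L ∸ i) (cong suc split)))

iter : {A : Set} → (A → A) → ℕ → A → A
iter f zero    x = x
iter f (suc k) x = f (iter f k x)

-- A forest with an apex: hub is the common parent of all roots, and next to
-- the edges x — parent x there are edges from hub to the marked vertices.
module Apex {V : Set} (hub : V) (par : V → V) (depth : V → ℕ) (Mark : V → Set)
            (depth-par : ∀ v → v ≢ hub → depth v ≡ suc (depth (par v))) where

  Up : V → V → Set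
  Up u v = u ≢ hub × (par u ≡ v ⊎ (v ≡ hub × Mark u))

  Adj : V → V → Set
  Adj u v = Up u v ⊎ Up v u

  Attached : V → Set
  Attached a = a ≢ hub × (par a ≡ hub ⊎ Mark a)

  to-hub : ∀ {a} → Adj hub a → Attached a
  to-hub (inj₁ (h , _))             = ⊥-elim (h refl)
  to-hub (inj₂ (h , inj₁ p))        = h , inj₁ p
  to-hub (inj₂ (h , inj₂ (_ , m)))  = h , inj₂ m

  away : ∀ {u v} → u ≢ hub → v ≢ hub → Adj u v → par u ≡ v ⊎ par v ≡ u
  away u≢ v≢ (inj₁ (_ , inj₁ p))       = inj₁ p
  away u≢ v≢ (inj₁ (_ , inj₂ (e , _))) = ⊥-elim (v≢ e)
  away u≢ v≢ (inj₂ (_ , inj₁ p))       = inj₂ p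
  away u≢ v≢ (inj₂ (_ , inj₂ (e , _))) = ⊥-elim (u≢ e)

  module _ {l : ℕ} (w : ClosedWalk Adj (3 + l)) where
    private L = 3 + l

    -- A walk in a forest that never turns back, once it moves away from the
    -- root, does so forever; so the depth is eventually strictly monotone.
    meets-hub : ¬ (∀ i → at w i ≢ hub)
    meets-hub never = absurd-up
      where
      step : ∀ i → par (at w i) ≡ at w (suc i) ⊎ par (at w (suc i)) ≡ at w i
      step i = away (never i) (never (suc i)) (edge w i)

      down-stays : ∀ i → par (at w (suc i)) ≡ at w i → par (at w (2 + i)) ≡ at w (suc i)
      down-stays i d with step (suc i)
      ... | inj₂ d′ = d′
      -- Turning back would repeat a vertex after two steps, impossible in a cycle of length at
      -- least 3.
      ... | inj₁ u  = ⊥-elim (simple w i 2 (s≤s z≤n) (s≤s (s≤s (s≤s z≤n)))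
                        (trans (sym d) (trans u (cong (at w) (+-comm 2 i)))))

      down-depth : ∀ i → par (at w (suc i)) ≡ at w i → ∀ k → depth (at w (suc k + i)) ≡ suc k + depth (at w i)
      down-depth i d k = proj₁ (go k)
        where
        go : ∀ k → depth (at w (suc k + i)) ≡ suc k + depth (at w i) × par (at w (suc k + i)) ≡ at w (k + i)
        go zero    = trans (depth-par _ (never _)) (cong (λ v → suc (depth v)) d) , d
        go (suc k) = let e , p = go k ; q = down-stays (k + i) p in
          trans (depth-par _ (never _)) (cong suc (trans (cong depth q) e)) , q

      no-down : ∀ i → par (at w (suc i)) ≢ at w i
      no-down i d = m≢1+n+m (depth (at w i))
        (trans (cong depth (trans (sym (period w i)) (cong (at w) (+-comm i L)))) (down-depth i d (2 + l)))

      up-depth : ∀ k → depth (at w 0) ≡ k + depth (at w k)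
      up-depth zero    = refl
      up-depth (suc k) with step k
      ... | inj₂ d = ⊥-elim (no-down k d)
      ... | inj₁ u = trans (up-depth k) (trans (cong (k +_)
                       (trans (depth-par _ (never k)) (cong (λ v → suc (depth v)) u))) (+-suc k _))

      absurd-up : ⊥
      absurd-up = m≢1+n+m (depth (at w 0)) (trans (up-depth L) (cong (λ v → L + depth v) (period w 0)))

    -- A step to a child cannot be followed by a step to a parent, as this would turn back. So
    -- between two visits to the hub the walk makes `k` steps to parents and then `m` steps to
    -- children. The descent is recorded from its far end, by iterated parents of the last vertex.
    record Arch : Set where
      field
        k m       : ℕ
        steps     : k + m ≡ 1 + l
        start-att : Attached (at w 1)
        end-att   : Attached (at w (2 + l))
        rise      : ∀ t → t ≤ k → at w (1 + t) ≡ iter par t (at w 1)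
        fall      : ∀ s t → s + t ≡ m → at w (1 + k + s) ≡ iter par t (at w (2 + l))

    module _ (hub₀ : at w 0 ≡ hub) where
      off-hub : ∀ i → i < 2 + l → at w (suc i) ≢ hub
      off-hub i i< e = simple w 0 (suc i) (s≤s z≤n) (s≤s i<) (trans hub₀ (sym e))

      private
        attached : ∀ i j → i < 2 + l → at w j ≡ hub → Adj (at w j) (at w (suc i)) → Attached (at w (suc i))
        attached i j i< e a = to-hub (subst (λ v → Adj v _) e a)

        flip : ∀ {u v} → Adj u v → Adj v u
        flip (inj₁ x) = inj₂ x
        flip (inj₂ x) = inj₁ x

        Phase : ℕ → Set
        Phase n = Σ[ k ∈ ℕ ] Σ[ m ∈ ℕ ] (k + m ≡ n)
          × (∀ t → t ≤ k → at w (1 + t) ≡ iter par t (at w 1))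
          × (∀ s t → s + t ≡ m → at w (1 + k + s) ≡ iter par t (at w (1 + n)))

        iter-suc : ∀ t (v : V) → iter par (suc t) v ≡ iter par t (par v)
        iter-suc zero    v = refl
        iter-suc (suc t) v = cong par (iter-suc t v)

        phase : ∀ n → n < 2 + l → Phase n
        phase zero    _  = 0 , 0 , refl , (λ { zero z≤n → refl }) ,
                           λ { zero zero refl → refl }
        phase (suc n) n< with phase n (<-trans (n<1+n n) n<)
                            | away (off-hub n (<-trans (n<1+n n) n<)) (off-hub (suc n) n<) (edge w (suc n))
        ... | k , m , km , r , f | inj₂ d = k , suc m , trans (+-suc k m) (cong suc km) , r , f′
          where
          f′ : ∀ s t → s + t ≡ suc m → at w (1 + k + s) ≡ iter par t (at w (2 + n))
          f′ s zero    e = cong (at w) (cong suc (trans (cong (k +_) (trans (sym (+-identityʳ s)) e)) (trans (+-suc k m) (cong suc km))))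
          f′ s (suc t) e = trans (f s t (suc-injective (trans (sym (+-suc s t)) e)))
                             (trans (cong (iter par t) (sym d)) (sym (iter-suc t _)))
        ... | k , zero , km , r , f | inj₁ u = suc k , 0 , cong suc km , r′ , f′
          where
          k≡n : k ≡ n
          k≡n = trans (sym (+-identityʳ k)) km
          r′ : ∀ t → t ≤ suc k → at w (1 + t) ≡ iter par t (at w 1)
          r′ t t≤ with m≤n⇒m<n∨m≡n t≤
          ... | inj₁ t<   = r t (≤-pred t<)
          ... | inj₂ refl = trans (cong (λ j → at w (2 + j)) k≡n)
                              (trans (sym u) (cong par (trans (cong (λ j → at w (suc j)) (sym k≡n)) (r k ≤-refl))))
          f′ : ∀ s t → s + t ≡ 0 → at w (1 + suc k + s) ≡ iter par t (at w (2 + n))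
          f′ zero zero refl = cong (λ j → at w (2 + j)) (trans (+-identityʳ k) k≡n)
        ... | k , suc m , km , r , f | inj₁ u = ⊥-elim (simple w (suc k + m) 2 (s≤s z≤n) (s≤s (s≤s (s≤s z≤n))) clash)
          where
          clash : at w (suc k + m) ≡ at w (suc k + m + 2)
          clash = trans (f m 1 (+-comm m 1)) (trans u (cong (at w)
                    (sym (trans (+-comm (suc k + m) 2) (cong (2 +_) (trans (sym (+-suc k m)) km))))))

      arch : Arch
      arch = let k , m , km , r , f = phase (1 + l) ≤-refl in record
        { k = k ; m = m ; steps = km
        ; start-att = attached 0 0 (s≤s z≤n) hub₀ (edge w 0)
        ; end-att   = attached (suc l) (3 + l) ≤-refl (trans (period w 0) hub₀) (flip (edge w (2 + l)))
        ; rise = r ; fall = f }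

-- Caterpillars

-- A block is a main path hanging from the hub, with side paths attached to it:
-- side j starts at height foot β j of the main path, has size β j vertices, and
-- its last vertex is adjacent to the hub.  The root of the main path counts as
-- side 0, with foot 0 and no vertices.
data Vertex (B : Set) : Set where
  hub  : Vertex B
  main : B → ℕ → Vertex B
  side : B → ℕ → ℕ → Vertex B

module Caterpillars {B : Set} (foot size : B → ℕ → ℕ)
  (foot-root : ∀ β → foot β 0 ≡ 0) (size-root : ∀ β → size β 0 ≡ 0) where

  parent : Vertex B → Vertex B
  parent hub                = hub
  parent (main β zero)      = hub
  parent (main β (suc d))   = main β d
  parent (side β j zero)    = main β (foot β j)
  parent (side β j (suc h)) = side β j h

  depth : Vertex B → ℕ
  depth hub          = 0
  depth (main β d)   = suc d
  depth (side β j h) = suc h + suc (foot β j)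

  Marked : Vertex B → Set
  Marked (side β j h) = suc h ≡ size β j
  Marked _            = ⊥

  depth-parent : ∀ v → v ≢ hub → depth v ≡ suc (depth (parent v))
  depth-parent hub                h≢ = ⊥-elim (h≢ refl)
  depth-parent (main β zero)      _  = refl
  depth-parent (main β (suc d))   _  = refl
  depth-parent (side β j zero)    _  = refl
  depth-parent (side β j (suc h)) _  = refl

  open Apex hub parent depth Marked depth-parent public

  -- Height 0 is the foot on the main path. Therefore `tip β 0` is the root, and roots and ends of
  -- sides can be treated alike as the neighbours of the hub.
  climbed : B → ℕ → ℕ → Vertex B
  climbed β j zero    = main β (foot β j)
  climbed β j (suc h) = side β j h

  tip : B → ℕ → Vertex B
  tip β j = climbed β j (size β j)

  tip-root : ∀ β → tip β 0 ≡ main β 0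
  tip-root β rewrite size-root β | foot-root β = refl

  side-injective : ∀ {β β′ : B} {j j′ h h′} → side β j h ≡ side β′ j′ h′ → β ≡ β′ × j ≡ j′
  side-injective refl = refl , refl

  main-injective : ∀ {β β′ : B} {d d′} → main β d ≡ main β′ d′ → β ≡ β′ × d ≡ d′
  main-injective refl = refl , refl

  -- The invariant of a climb of `k` steps from a tip: it is still on the side, or it has left the
  -- side behind and is on the main path.
  Position : B → ℕ → ℕ → Vertex B → Set
  Position β j k p = (Σ[ h ∈ ℕ ] p ≡ side β j h × k + suc h ≡ size β j)
                   ⊎ (Σ[ d ∈ ℕ ] p ≡ main β d × k + d ≡ size β j + foot β j × size β j ≤ k)

  start : ∀ β j → Position β j 0 (tip β j)
  start β j with size β j
  ... | zero  = inj₂ (foot β j , refl , refl , z≤n)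
  ... | suc h = inj₁ (h , refl , refl)

  advance : ∀ {β j k p} → parent p ≢ hub → Position β j k p → Position β j (suc k) (parent p)
  advance {k = k} _ (inj₁ (zero , refl , e)) =
    inj₂ (_ , refl , cong (_+ _) k+1 , ≤-reflexive (sym k+1))
    where k+1 = trans (+-comm 1 k) e
  advance {k = k} _ (inj₁ (suc h , refl , e)) = inj₁ (h , refl , trans (sym (+-suc k (suc h))) e)
  advance ph (inj₂ (zero , refl , _)) = ⊥-elim (ph refl)
  advance {k = k} _ (inj₂ (suc d , refl , e , s)) = inj₂ (d , refl , trans (sym (+-suc k d)) e , m≤n⇒m≤1+n s)

  climb : ∀ β j k → iter parent k (tip β j) ≢ hub → Position β j k (iter parent k (tip β j))
  climb β j zero    _ = start β j
  climb β j (suc k) n = advance n (climb β j k (λ e → n (cong parent e)))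

  attached-tip : ∀ {a} → Attached a → Σ[ β ∈ B ] Σ[ j ∈ ℕ ]
    a ≡ tip β j × ((j ≡ 0 × a ≡ main β 0) ⊎ (Σ[ h ∈ ℕ ] a ≡ side β j h))
  attached-tip {hub} (h , _) = ⊥-elim (h refl)
  attached-tip {main β zero} _ = β , 0 , sym (tip-root β) , inj₁ (refl , refl)
  attached-tip {main β (suc d)} (_ , inj₁ ())
  attached-tip {main β (suc d)} (_ , inj₂ ())
  attached-tip {side β j zero} (_ , inj₁ ())
  attached-tip {side β j (suc h)} (_ , inj₁ ())
  attached-tip {side β j h} (_ , inj₂ m) = β , j , cong (climbed β j) m , inj₂ (h , refl)

  just-below : ∀ {β i k d} → iter parent k (tip β i) ≢ hub → suc k + d ≡ size β i + foot β i →
    d < foot β i → iter parent k (tip β i) ≡ main β (suc d)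
  just-below {β} {i} {k} {d} nh e d< with climb β i k nh
  ... | inj₁ (h , _ , q) = ⊥-elim (m+1+n≰m k (≤-trans (≤-reflexive q) size≤k))
    where
    size≤k : size β i ≤ k
    size≤k = +-cancelʳ-≤ (suc d) (size β i) k
      (≤-trans (+-monoʳ-≤ (size β i) d<) (≤-reflexive (trans (sym e) (sym (+-suc k d)))))
  ... | inj₂ (c , p , q , _) = trans p (cong (main β) (+-cancelˡ-≡ k c (suc d)
          (trans q (trans (sym e) (sym (+-suc k d))))))

  -- Two tips climb until their paths meet, at the foot of the earlier side.
  meet : ∀ {β i β′ j k m} → iter parent k (tip β i) ≡ iter parent m (tip β′ j) →
    iter parent k (tip β i) ≢ hub → tip β i ≢ tip β′ j →
    β ≡ β′ × Σ[ d ∈ ℕ ] (k + d ≡ size β i + foot β i × m + d ≡ size β′ j + foot β′ j × size β i ≤ k)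
  meet {β} {i} {β′} {j} {k} {m} e nh tips≢
    with climb β i k nh | climb β′ j m (λ x → nh (trans e x))
  ... | inj₁ (_ , p , _) | inj₁ (_ , p′ , _) with side-injective (trans (sym p) (trans e p′))
  ...   | refl , refl = ⊥-elim (tips≢ refl)
  meet e nh _ | inj₁ (_ , p , _) | inj₂ (_ , p′ , _) with () ← trans (sym p) (trans e p′)
  meet e nh _ | inj₂ (_ , p , _) | inj₁ (_ , p′ , _) with () ← trans (sym p) (trans e p′)
  meet e nh _ | inj₂ (d , p , kd , s) | inj₂ (_ , p′ , md , _)
    with main-injective (trans (sym p) (trans e p′))
  ... | refl , refl = refl , d , kd , md , s

  -- If the climbs met nearer to the root than the foot of side `i`, both would have entered the
  -- meeting vertex from the same vertex of the main path, contrary to `first`. So they meet exactly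
  -- at that foot, which fixes both numbers of steps.
  meet-foot : ∀ {β i j k m d} → foot β i ≤ foot β j →
    iter parent k (tip β i) ≡ iter parent m (tip β j) →
    iter parent k (tip β i) ≢ hub →
    (∀ k′ m′ → k ≡ suc k′ → m ≡ suc m′ → iter parent k′ (tip β i) ≢ iter parent m′ (tip β j)) →
    k + d ≡ size β i + foot β i → m + d ≡ size β j + foot β j → size β i ≤ k →
    k ≡ size β i × m + foot β i ≡ size β j + foot β j
  meet-foot {β} {i} {j} {k} {m} {d} ij e nh first kd md s =
    +-cancelʳ-≡ (foot β i) k (size β i) (trans (cong (k +_) (sym d≡)) kd) , trans (cong (m +_) (sym d≡)) md
    where
    not-below : ∀ k m → iter parent k (tip β i) ≡ iter parent m (tip β j) → iter parent k (tip β i) ≢ hub →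
      (∀ k′ m′ → k ≡ suc k′ → m ≡ suc m′ → iter parent k′ (tip β i) ≢ iter parent m′ (tip β j)) →
      k + d ≡ size β i + foot β i → m + d ≡ size β j + foot β j → ¬ (d < foot β i)
    not-below zero    _       _ _  _     q _ d< = <-irrefl q (≤-trans d< (m≤n+m _ (size β i)))
    not-below (suc _) zero    _ _  _     _ q d< = <-irrefl q (≤-trans (≤-trans d< ij) (m≤n+m _ (size β j)))
    not-below (suc k) (suc m) e nh first q r d< = first k m refl refl (trans
      (just-below (λ x → nh (cong parent x)) q d<)
      (sym (just-below (λ x → nh (trans e (cong parent x))) r (≤-trans d< ij))))
    d≡ : d ≡ foot β i
    d≡ with m≤n⇒m<n∨m≡n (+-cancelˡ-≤ (size β i) d (foot β i) (≤-trans (+-monoˡ-≤ d s) (≤-reflexive kd)))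
    ... | inj₁ d< = ⊥-elim (not-below k m e nh first kd md d<)
    ... | inj₂ q  = q

  -- Classification of the cycles in a forest of caterpillars

  hub? : (v : Vertex B) → Dec (v ≡ hub)
  hub? hub          = yes refl
  hub? (main _ _)   = no λ ()
  hub? (side _ _ _) = no λ ()

  visits-hub : ∀ {l} (w : ClosedWalk Adj (3 + l)) → ∃ λ s → at w s ≡ hub
  visits-hub {l} w with anyUpTo? (λ s → hub? (at w s)) (3 + l)
  ... | yes (s , _ , e) = s , e
  ... | no none = ⊥-elim (meets-hub w λ i e → none (i % (3 + l) , m%n<n i (3 + l) , trans (sym (at-% w i)) e))

  -- From the hub, `g` runs from the tip of side `i` to its foot, then along the main path and out
  -- to the tip of side `j`. It is a plain function so that it can be a walk or its reversal.
  record Follows (g : ℕ → Vertex B) (l : ℕ) (β : B) (i j : ℕ) : Set where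
    constructor follows
    field
      rest   : ℕ
      total  : size β i + rest ≡ 1 + l
      height : rest + foot β i ≡ size β j + foot β j
      out    : ∀ t → t ≤ size β i → g (1 + t) ≡ iter parent t (tip β i)
      back   : ∀ s t → s + t ≡ rest → g (1 + size β i + s) ≡ iter parent t (tip β j)

  backwards : ∀ {L} → ClosedWalk Adj L → ℕ → Vertex B
  backwards {L} w t = at w (L ∸ t)

  -- The vertices are the hub, the two sides, and the main path from one foot to the other
  -- inclusive; hub and inclusive end account for the 2.
  follows-length : ∀ {g l β i j} → Follows g l β i j → 3 + l + foot β i ≡ 2 + size β i + size β j + foot β j
  follows-length {g} {l} {β} {i} {j} (follows m t h _ _) = cong (2 +_) (begin
    suc l + foot β i             ≡⟨ cong (_+ foot β i) (sym t) ⟩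
    size β i + m + foot β i      ≡⟨ +-assoc (size β i) m _ ⟩
    size β i + (m + foot β i)    ≡⟨ cong (size β i +_) h ⟩
    size β i + (size β j + foot β j) ≡⟨ sym (+-assoc (size β i) _ _) ⟩
    size β i + size β j + foot β j ∎)
    where open ≡-Reasoning

  follows-unique : ∀ {g g′ l β i j} → Follows g l β i j → Follows g′ l β i j →
    g 0 ≡ g′ 0 → g (3 + l) ≡ g′ (3 + l) → ∀ t → t ≤ 3 + l → g t ≡ g′ t
  follows-unique _ _ e₀ _ zero _ = e₀
  follows-unique {g} {g′} {l} {β} {i} (follows m e h o b) (follows m′ e′ h′ o′ b′) _ e₁ (suc t) t≤
    with t ≤? size β i
  ... | yes t≤i = trans (o t t≤i) (sym (o′ t t≤i))
  ... | no  t≰i with m≤n⇒m<n∨m≡n t≤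
  ...   | inj₂ refl = e₁
  ...   | inj₁ t< = trans (cong (λ x → g (suc x)) (sym split))
                   (trans (b s (m ∸ s) (m+[n∸m]≡n s≤))
                   (sym (trans (cong (λ x → g′ (suc x)) (sym split)) (b′ s (m ∸ s) (trans (m+[n∸m]≡n s≤) m≡m′)))))
    where
    s = t ∸ size β i
    split : size β i + s ≡ t
    split = m+[n∸m]≡n (<⇒≤ (≰⇒> t≰i))
    s≤ : s ≤ m
    s≤ = +-cancelˡ-≤ (size β i) s m (≤-trans (≤-reflexive split) (≤-trans (≤-pred (≤-pred t<)) (≤-reflexive (sym e))))
    m≡m′ : m ≡ m′
    m≡m′ = +-cancelˡ-≡ (size β i) m m′ (trans e (sym e′))

  module _ (Side : B → ℕ → Set) (mono : ∀ {β i j} → Side β j → i ≤ j → foot β i ≤ foot β j)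
           (InGraph : Vertex B → Set) (known : ∀ {β j h} → InGraph (side β j h) → Side β j) where

    record Classified {l} (w : ClosedWalk Adj (3 + l)) : Set where
      constructor classified
      field
        block : B
        lower upper : ℕ
        i<j   : lower < upper
        upper-side : Side block upper
        course : Follows (at w) l block lower upper ⊎ Follows (backwards w) l block lower upper

    -- Both neighbours of the hub on the walk are tips of one block. The one with the smaller number
    -- is taken as the start, which requires `backwards` if the walk visits it last.
    classify : ∀ {l} (w : ClosedWalk Adj (3 + l)) → (∀ i → InGraph (at w i)) → at w 0 ≡ hub → Classified w
    classify {l} w ok hub₀ = go (attached-tip A.start-att) (attached-tip A.end-att)
      where
      module A = Arch (arch w hub₀)
      a = at w 1
      b = at w (2 + l)
      top : iter parent A.k a ≡ iter parent A.m b
      top = trans (sym (A.rise A.k ≤-refl)) (trans (cong (at w) (sym (+-identityʳ _))) (A.fall 0 A.m refl))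
      top≢ : iter parent A.k a ≢ hub
      top≢ e = off-hub w hub₀ A.k (s≤s (≤-trans (m≤m+n A.k A.m) (≤-reflexive A.steps))) (trans (A.rise A.k ≤-refl) e)
      first : ∀ k m → A.k ≡ suc k → A.m ≡ suc m → iter parent k a ≢ iter parent m b
      first k m p q e = simple w (suc k) 2 (s≤s z≤n) (s≤s (s≤s (s≤s z≤n)))
        (trans (A.rise k (≤-trans (n≤1+n k) (≤-reflexive (sym p))))
        (trans e (trans (sym (A.fall 1 m (sym q))) (cong (at w) (trans (cong (λ x → 1 + x + 1) p)
          (cong suc (trans (+-comm (suc k) 1) (+-comm 2 k))))))))
      a≢b : a ≢ b
      a≢b e = simple w 1 (1 + l) (s≤s z≤n) (s≤s (n≤1+n (suc l))) e

      forward : ∀ {β i j} → a ≡ tip β i → b ≡ tip β j → A.k ≡ size β i → A.m + foot β i ≡ size β j + foot β j →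
        Follows (at w) l β i j
      forward refl′ eb ek em = follows A.m (trans (cong (_+ A.m) (sym ek)) A.steps) em
        (λ t t≤ → trans (A.rise t (≤-trans t≤ (≤-reflexive (sym ek)))) (cong (iter parent t) refl′))
        (λ s t e → trans (cong (λ x → at w (1 + x + s)) (sym ek)) (trans (A.fall s t e) (cong (iter parent t) eb)))

      backward : ∀ {β i j} → b ≡ tip β i → a ≡ tip β j → A.m ≡ size β i → A.k + foot β i ≡ size β j + foot β j →
        Follows (backwards w) l β i j
      backward {β} {i} eb ea em ek = follows A.k (trans (+-comm _ A.k) (trans (cong (A.k +_) (sym em)) A.steps)) ek
        (λ t t≤ → let t≤m = ≤-trans t≤ (≤-reflexive (sym em)) in
           trans (cong (at w) (down t t≤m)) (trans (A.fall (A.m ∸ t) t (m∸n+n≡m t≤m)) (cong (iter parent t) eb)))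
        (λ s t e → trans (cong (at w) (up s t e)) (trans (A.rise t (≤-trans (m≤n+m t s) (≤-reflexive e))) (cong (iter parent t) ea)))
        where
        down : ∀ t → t ≤ A.m → 2 + l ∸ t ≡ 1 + A.k + (A.m ∸ t)
        down t t≤ = trans (cong (_∸ t) (cong suc (sym A.steps))) (+-∸-assoc (1 + A.k) t≤)
        up : ∀ s t → s + t ≡ A.k → 2 + l ∸ (size β i + s) ≡ 1 + t
        up s t e = trans (cong₂ _∸_ (trans (cong suc (sym A.steps)) (trans (cong (λ x → suc (x + A.m)) (sym e))
          (trans (cong (λ x → suc (x + A.m)) (+-comm s t)) (trans (cong suc (+-assoc t s A.m)) (cong (λ x → suc (t + x)) (+-comm s A.m))))))
          (cong (_+ s) (sym em))) (m+n∸n≡m (suc t) (A.m + s))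

      go : (Σ[ β ∈ B ] Σ[ i ∈ ℕ ] a ≡ tip β i × ((i ≡ 0 × a ≡ main β 0) ⊎ (Σ[ h ∈ ℕ ] a ≡ side β i h))) →
           (Σ[ β ∈ B ] Σ[ i ∈ ℕ ] b ≡ tip β i × ((i ≡ 0 × b ≡ main β 0) ⊎ (Σ[ h ∈ ℕ ] b ≡ side β i h))) →
           Classified w
      go (β , i , ea , ka) (β′ , j , eb , kb)
        -- `meet` bounds only the climb from its first tip, so it is applied in both orders before
        -- the sides are compared.
        with meet {k = A.k} {m = A.m} (subst₂ (λ x y → iter parent A.k x ≡ iter parent A.m y) ea eb top)
                  (subst (λ x → iter parent A.k x ≢ hub) ea top≢)
                  (subst₂ _≢_ ea eb a≢b)
           | meet {k = A.m} {m = A.k} (subst₂ (λ x y → iter parent A.m y ≡ iter parent A.k x) ea eb (sym top))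
                  (subst (λ x → iter parent A.m x ≢ hub) eb (λ e → top≢ (trans top e)))
                  (subst₂ _≢_ eb ea (λ e → a≢b (sym e)))
      ... | refl , d , kd , md , s | _ , _ , _ , _ , s′ with <-cmp i j
      ...   | tri≈ _ refl _ = ⊥-elim (a≢b (trans ea (sym eb)))
      ...   | tri< i<j _ _ = classified β i j i<j sj (inj₁ (forward ea eb (proj₁ r) (proj₂ r)))
        where
        sj : Side β j
        sj = either (λ (e , _) → ⊥-elim (n≮0 (subst (i <_) e i<j))) (λ (_ , e) → known (subst InGraph e (ok (2 + l)))) kb
        r = meet-foot (mono sj (<⇒≤ i<j)) (subst₂ (λ x y → iter parent A.k x ≡ iter parent A.m y) ea eb top)
              (subst (λ x → iter parent A.k x ≢ hub) ea top≢)
              (λ k m p q → subst₂ (λ x y → iter parent k x ≢ iter parent m y) ea eb (first k m p q)) kd md s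
      ...   | tri> _ _ j<i = classified β j i j<i si (inj₂ (backward eb ea (proj₁ r) (proj₂ r)))
        where
        si : Side β i
        si = either (λ (e , _) → ⊥-elim (n≮0 (subst (j <_) e j<i))) (λ (_ , e) → known (subst InGraph e (ok 1))) ka
        r = meet-foot (mono si (<⇒≤ j<i)) (subst₂ (λ x y → iter parent A.m y ≡ iter parent A.k x) ea eb (sym top))
              (subst (λ x → iter parent A.m x ≢ hub) eb (λ e → top≢ (trans top e)))
              (λ m k q p e → subst₂ (λ x y → iter parent k x ≢ iter parent m y) ea eb (first k m p q) (sym e)) md kd s′

    module _ (unique : ∀ {β i j β′ i′ j′} → i < j → Side β j → i′ < j′ → Side β′ j′ → ∀ L →
                L + foot β i ≡ 2 + size β i + size β j + foot β j →
                L + foot β′ i′ ≡ 2 + size β′ i′ + size β′ j′ + foot β′ j′ →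
                (β , i , j) ≡ (β′ , i′ , j′)) where

      -- By `unique` the length determines the block and the two sides, and these determine the walk
      -- up to direction. Equal directions give the same sequence, opposite ones the mirrored
      -- sequence.
      same-length-from-hub : ∀ {l} (w w′ : ClosedWalk Adj (3 + l)) →
        (∀ i → InGraph (at w i)) → (∀ i → InGraph (at w′ i)) → at w 0 ≡ hub → at w′ 0 ≡ hub →
        ∀ {x y} → Traverses w x y → Traverses w′ x y
      same-length-from-hub {l} w w′ ok ok′ e e′ with classify w ok e | classify w′ ok′ e′
      ... | classified β i j lt s c | classified β′ i′ j′ lt′ s′ c′
        with unique lt s lt′ s′ (3 + l) (len {w} c) (len {w′} c′)
        where
        len : ∀ {v β i j} → Follows (at v) l β i j ⊎ Follows (backwards {3 + l} v) l β i j →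
              3 + l + foot β i ≡ 2 + size β i + size β j + foot β j
        len (inj₁ f) = follows-length f
        len (inj₂ f) = follows-length f
      ... | refl = traverse c c′
        where
        hub≡ : at w 0 ≡ at w′ 0
        hub≡ = trans e (sym e′)
        w₀ : at w (3 + l) ≡ hub
        w₀ = trans (period w 0) e
        w′₀ : at w′ (3 + l) ≡ hub
        w′₀ = trans (period w′ 0) e′
        end : ∀ {L} (v : ClosedWalk Adj L) → at v 0 ≡ hub → at v (L ∸ L) ≡ hub
        end {L} v p = trans (cong (at v) (n∸n≡0 L)) p
        complement : ∀ {t u} → t + u ≡ 3 + l → 3 + l ∸ t ≡ u
        complement {t} {u} p = trans (cong (_∸ t) (sym p)) (m+n∸m≡n t u)
        traverse : Follows (at w) l β i j ⊎ Follows (backwards w) l β i j →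
                   Follows (at w′) l β i j ⊎ Follows (backwards w′) l β i j →
                   ∀ {x y} → Traverses w x y → Traverses w′ x y
        traverse (inj₁ f) (inj₁ f′) = same⇒traverses w w′ (follows-unique f f′ hub≡ (trans w₀ (sym w′₀)))
        traverse (inj₁ f) (inj₂ f′) = reversed⇒traverses w w′ λ t u p →
          trans (follows-unique f f′ (trans e (sym w′₀)) (trans w₀ (sym (end w′ e′))) t (≤-trans (m≤m+n t u) (≤-reflexive p)))
                (cong (at w′) (complement p))
        traverse (inj₂ f) (inj₁ f′) = reversed⇒traverses w w′ λ t u p →
          trans (cong (at w) (sym (complement (trans (+-comm u t) p))))
                (follows-unique f f′ (trans w₀ (sym e′)) (trans (end w e) (sym w′₀)) u (≤-trans (m≤n+m u t) (≤-reflexive p)))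
        traverse (inj₂ f) (inj₂ f′) = same⇒traverses w w′ λ t t≤ →
          trans (cong (at w) (sym (m∸[m∸n]≡n t≤)))
          (trans (follows-unique f f′ (trans w₀ (sym w′₀)) (trans (end w e) (sym (end w′ e′))) (3 + l ∸ t) (m∸n≤m (3 + l) t))
                 (cong (at w′) (m∸[m∸n]≡n t≤)))

      same-length : ∀ {l} (w w′ : ClosedWalk Adj (3 + l)) →
        (∀ i → InGraph (at w i)) → (∀ i → InGraph (at w′ i)) →
        ∀ {x y} → Traverses w x y → Traverses w′ x y
      same-length w w′ ok ok′ t with visits-hub w | visits-hub w′
      ... | s , e | s′ , e′ = rotate-traverses⁻ s′ w′
        (same-length-from-hub (rotate s w) (rotate s′ w′) (λ i → ok (s + i)) (λ i → ok′ (s′ + i))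
          (trans (cong (at w) (+-identityʳ s)) e) (trans (cong (at w′) (+-identityʳ s′)) e′)
          (rotate-traverses s w t))

-- Graphs given by lists of vertices

lookup-injective : ∀ {A : Set} {xs : List A} → Unique xs → ∀ i j → lookup xs i ≡ lookup xs j → i ≡ j
lookup-injective (_ ∷ _)  fzero    fzero    _ = refl
lookup-injective (p ∷ _)  fzero    (fsuc j) e = ⊥-elim (All.lookup p (∈-lookup j) e)
lookup-injective (p ∷ _)  (fsuc i) fzero    e = ⊥-elim (All.lookup p (∈-lookup i) (sym e))
lookup-injective (_ ∷ us) (fsuc i) (fsuc j) e = cong fsuc (lookup-injective us i j e)

%≢%-shift : ∀ L .{{_ : NonZero L}} i d → 0 < d → d < L → i % L ≢ (i + d) % L
%≢%-shift L i (suc d) _ d<L e = <⇒≱ d<L (∣⇒≤ (∣m+n∣m⇒∣n L∣ (n∣m*n (i / L))))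
  where
  quotients : i / L * L + suc d ≡ (i + suc d) / L * L
  quotients = +-cancelˡ-≡ (i % L) _ _ (begin
    i % L + (i / L * L + suc d)              ≡⟨ sym (+-assoc (i % L) _ _) ⟩
    i % L + i / L * L + suc d                ≡⟨ cong (_+ suc d) (sym (m≡m%n+[m/n]*n i L)) ⟩
    i + suc d                                ≡⟨ m≡m%n+[m/n]*n (i + suc d) L ⟩
    (i + suc d) % L + (i + suc d) / L * L    ≡⟨ cong (_+ (i + suc d) / L * L) (sym e) ⟩
    i % L + (i + suc d) / L * L              ∎)
    where open ≡-Reasoning
  L∣ : L ∣ i / L * L + suc d
  L∣ = subst (L ∣_) (sym quotients) (n∣m*n ((i + suc d) / L))

toℕ-mod : ∀ i L .{{_ : NonZero L}} → toℕ (i mod L) ≡ i % L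
toℕ-mod i L = toℕ-fromℕ< (m%n<n i L)

mod-cong : ∀ {i j} L .{{_ : NonZero L}} → i % L ≡ j % L → i mod L ≡ j mod L
mod-cong {i} {j} L e = toℕ-injective (trans (toℕ-mod i L) (trans e (sym (toℕ-mod j L))))

Consecutive : ∀ m → Fin (suc m) → Fin (suc m) → Set
Consecutive m x y = (Σ[ k ∈ Fin m ] x ≡ inject₁ k × y ≡ fsuc k) ⊎ (x ≡ fromℕ m × y ≡ fzero)

mod-consecutive : ∀ m i → Consecutive m (i mod suc m) (suc i mod suc m)
mod-consecutive m i = go (m≤n⇒m<n∨m≡n (≤-pred (m%n<n i (suc m))))
  where
  r = i % suc m
  next : suc i % suc m ≡ suc r % suc m
  next = trans (cong (λ x → suc x % suc m) (m≡m%n+[m/n]*n i (suc m))) ([m+kn]%n≡m%n (suc r) (i / suc m) (suc m))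
  go : r < m ⊎ r ≡ m → Consecutive m (i mod suc m) (suc i mod suc m)
  go (inj₁ r<m) = inj₁ (fromℕ< r<m ,
    toℕ-injective (trans (toℕ-mod i (suc m)) (sym (trans (toℕ-inject₁ _) (toℕ-fromℕ< r<m)))) ,
    toℕ-injective (trans (toℕ-mod (suc i) (suc m)) (trans next (trans (m<n⇒m%n≡m (s≤s r<m)) (cong suc (sym (toℕ-fromℕ< r<m)))))))
  go (inj₂ r≡m) = inj₂ (
    toℕ-injective (trans (toℕ-mod i (suc m)) (trans r≡m (sym (toℕ-fromℕ m)))) ,
    toℕ-injective (trans (toℕ-mod (suc i) (suc m)) (trans next (trans (cong (λ x → suc x % suc m) r≡m) (n%n≡0 (suc m))))))

mod-toℕ : ∀ {m} (k : Fin (suc m)) → toℕ k mod suc m ≡ k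
mod-toℕ {m} k = toℕ-injective (trans (toℕ-mod (toℕ k) (suc m)) (m<n⇒m%n≡m (toℕ<n k)))

module InducedGraph {V : Set} (Adj : V → V → Set) (adj? : ∀ u v → Dec (Adj u v))
         (Adj-irrefl : ∀ v → ¬ Adj v v) (Adj-sym : ∀ {u v} → Adj u v → Adj v u) where

  adjᵇ : V → V → Bool
  adjᵇ u v = does (adj? u v)

  adjᵇ-sym : ∀ u v → adjᵇ u v ≡ adjᵇ v u
  adjᵇ-sym u v with adj? v u
  ... | yes p = dec-true (adj? u v) (Adj-sym p)
  ... | no ¬p = dec-false (adj? u v) (λ q → ¬p (Adj-sym q))

  induced : (vs : List V) → SimpleGraph (length vs)
  induced vs = record
    { adj    = λ i j → adjᵇ (lookup vs i) (lookup vs j)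
    ; irrefl = λ i → dec-false (adj? _ _) (Adj-irrefl (lookup vs i))
    ; sym    = λ i j → adjᵇ-sym (lookup vs i) (lookup vs j)
    }

  adjᵇ⇒Adj : ∀ {u v} → adjᵇ u v ≡ true → Adj u v
  adjᵇ⇒Adj {u} {v} e with adj? u v
  ... | yes p = p

  module _ {xs : List V} (unique : Unique xs) where

    walk : (c : Cycle (induced xs)) → ClosedWalk Adj (cycleLength c)
    walk c = record
      { at     = λ i → lookup xs (Cycle.vs c (i mod L))
      ; period = λ i → cong (lookup xs ∘ Cycle.vs c) (mod-cong {i + L} {i} L ([m+n]%n≡m%n i L))
      ; simple = λ i d 0<d d<L e → %≢%-shift L i d 0<d d<L
          (trans (sym (toℕ-mod i L)) (trans (cong toℕ (Cycle.inj c _ _ (lookup-injective unique _ _ e))) (toℕ-mod (i + d) L)))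
      ; edge   = λ i → joined (mod-consecutive (2 + Cycle.m c) i)
      }
      where
      L = cycleLength c
      joined : ∀ {x y} → Consecutive (2 + Cycle.m c) x y → Adj (lookup xs (Cycle.vs c x)) (lookup xs (Cycle.vs c y))
      joined (inj₁ (k , refl , refl)) = adjᵇ⇒Adj (Cycle.step c k)
      joined (inj₂ (refl , refl))     = adjᵇ⇒Adj (Cycle.close c)

    uses⇒traverses : ∀ c {u v} → UsesEdge c u v → Traverses (walk c) (lookup xs u) (lookup xs v)
    uses⇒traverses c {u} {v} (inj₁ (k , e)) = toℕ (inject₁ k) , map⊎ image image e
      where
      L = cycleLength c
      image : ∀ {x y} → Cycle.vs c (inject₁ k) ≡ x × Cycle.vs c (fsuc k) ≡ y →
        at (walk c) (toℕ (inject₁ k)) ≡ lookup xs x × at (walk c) (suc (toℕ (inject₁ k))) ≡ lookup xs y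
      image (p , q) = cong (lookup xs) (trans (cong (Cycle.vs c) (mod-toℕ (inject₁ k))) p) ,
        cong (lookup xs) (trans (cong (Cycle.vs c) (trans (cong (λ x → suc x mod L) (toℕ-inject₁ k)) (mod-toℕ (fsuc k)))) q)
    uses⇒traverses c {u} {v} (inj₂ e) = 2 + Cycle.m c , map⊎ image image e
      where
      L = cycleLength c
      image : ∀ {x y} → Cycle.vs c (fromℕ (2 + Cycle.m c)) ≡ x × Cycle.vs c fzero ≡ y →
        at (walk c) (2 + Cycle.m c) ≡ lookup xs x × at (walk c) (3 + Cycle.m c) ≡ lookup xs y
      image (p , q) = cong (lookup xs) (trans (cong (Cycle.vs c) (trans (cong (_mod L) (sym (toℕ-fromℕ (2 + Cycle.m c)))) (mod-toℕ _))) p) ,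
        cong (lookup xs) (trans (cong (Cycle.vs c) (trans (mod-cong {L} {0} L (n%n≡0 L)) (mod-toℕ fzero))) q)

    traverses⇒uses : ∀ c {u v} → Traverses (walk c) (lookup xs u) (lookup xs v) → UsesEdge c u v
    traverses⇒uses c {u} {v} (i , e) = go (mod-consecutive (2 + Cycle.m c) i)
      (map⊎ (map× same same) (map× same same) e)
      where
      L = cycleLength c
      same : ∀ {x y} → lookup xs x ≡ lookup xs y → x ≡ y
      same = lookup-injective unique _ _
      go : ∀ {x y} → Consecutive (2 + Cycle.m c) x y →
        (Cycle.vs c x ≡ u × Cycle.vs c y ≡ v) ⊎ (Cycle.vs c x ≡ v × Cycle.vs c y ≡ u) → UsesEdge c u v
      go (inj₁ (k , refl , refl)) e = inj₁ (k , e)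
      go (inj₂ (refl , refl))     e = inj₂ e

    distinct-lengths : (∀ {l} (w w′ : ClosedWalk Adj (3 + l)) → (∀ i → at w i ∈ xs) → (∀ i → at w′ i ∈ xs) →
      ∀ {x y} → Traverses w x y → Traverses w′ x y) → DistinctCycleLengths (induced xs)
    distinct-lengths same c d len u v = (λ e → to c d len e) , (λ e → to d c (sym len) e)
      where
      to : ∀ c d → cycleLength c ≡ cycleLength d → ∀ {u v} → UsesEdge c u v → UsesEdge d u v
      to c d len {u} {v} e = traverses⇒uses d (transport (Cycle.m c) (suc-injective (suc-injective (suc-injective len))) (walk c)
          (λ i → ∈-lookup _) (uses⇒traverses c e))
        where
        -- The walk is generalised over `l`, so that the equality of the two lengths can be matched
        -- with `refl`.
        transport : ∀ l → l ≡ Cycle.m d → (w : ClosedWalk Adj (3 + l)) → (∀ i → at w i ∈ xs) →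
          Traverses w (lookup xs u) (lookup xs v) → Traverses (walk d) (lookup xs u) (lookup xs v)
        transport _ refl w ok = same w (walk d) ok (λ i → ∈-lookup _)

  indicator : Bool → ℕ
  indicator b = if b then 1 else 0

  degreeIn : V → List V → ℕ
  degreeIn v vs = sum (map (λ u → indicator (adjᵇ v u)) vs)

  -- Each edge is counted at the end that comes first in the list, so that adding a vertex in front
  -- adds its degree into the vertices already present.
  edges : List V → ℕ
  edges []       = 0
  edges (v ∷ vs) = degreeIn v vs + edges vs

  sum-allFin : ∀ {n} (g : Fin (suc n) → ℕ) →
    sum (map g (allFin (suc n))) ≡ g fzero + sum (map (g ∘ fsuc) (allFin n))
  sum-allFin {n} g = cong (λ xs → g fzero + sum xs) (trans (map-tabulate fsuc g) (sym (map-tabulate (λ i → i) (g ∘ fsuc))))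

  sum-lookup : ∀ (g : V → ℕ) vs → sum (map (g ∘ lookup vs) (allFin (length vs))) ≡ sum (map g vs)
  sum-lookup g []       = refl
  sum-lookup g (v ∷ vs) = trans (sum-allFin (g ∘ lookup (v ∷ vs))) (cong (g v +_) (sum-lookup g vs))

  sum-cong : ∀ {A : Set} {g h : A → ℕ} → (∀ x → g x ≡ h x) → ∀ xs → sum (map g xs) ≡ sum (map h xs)
  sum-cong e []       = refl
  sum-cong e (x ∷ xs) = cong₂ _+_ (e x) (sum-cong e xs)

  edgeCount-induced : ∀ vs → edgeCount (induced vs) ≡ edges vs
  edgeCount-induced []       = refl
  edgeCount-induced (v ∷ vs) = trans (sum-allFin row) (cong₂ _+_
      (trans (sum-allFin (entry fzero)) (sum-lookup (λ u → indicator (adjᵇ v u)) vs))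
      (trans (sum-cong (λ i → sum-allFin (entry (fsuc i))) (allFin (length vs))) (edgeCount-induced vs)))
    where
    entry : Fin (suc (length vs)) → Fin (suc (length vs)) → ℕ
    entry i j = indicator ((toℕ i <ᵇ toℕ j) ∧ SimpleGraph.adj (induced (v ∷ vs)) i j)
    row : Fin (suc (length vs)) → ℕ
    row i = sum (map (entry i) (allFin (suc (length vs))))

  degree≥1 : ∀ {v x vs} → Adj v x → x ∈ vs → 1 ≤ degreeIn v vs
  degree≥1 {v} {x} a (here refl) rewrite dec-true (adj? v x) a = s≤s z≤n
  degree≥1 {v} {vs = y ∷ _} a (there x∈) = ≤-trans (degree≥1 a x∈) (m≤n+m _ (indicator (adjᵇ v y)))

  degree≥2 : ∀ {v x y vs} → x ≢ y → Adj v x → Adj v y → x ∈ vs → y ∈ vs → 2 ≤ degreeIn v vs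
  degree≥2 x≢y a b (here refl) (here refl) = ⊥-elim (x≢y refl)
  degree≥2 {v} {x} x≢y a b (here refl) (there y∈) rewrite dec-true (adj? v x) a = s≤s (degree≥1 b y∈)
  degree≥2 {v} {x} {y} x≢y a b (there x∈) (here refl) rewrite dec-true (adj? v y) b = s≤s (degree≥1 a x∈)
  degree≥2 {v} {vs = z ∷ _} x≢y a b (there x∈) (there y∈) = ≤-trans (degree≥2 x≢y a b x∈ y∈) (m≤n+m _ (indicator (adjᵇ v z)))

-- Finite caterpillar graphs and their numbers of edges

module CaterpillarGraph {B : Set} (_≟ᴮ_ : DecidableEquality B) (foot size : B → ℕ → ℕ)
  (foot-root : ∀ β → foot β 0 ≡ 0) (size-root : ∀ β → size β 0 ≡ 0) where

  open Caterpillars foot size foot-root size-root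

  _≟ᵛ_ : DecidableEquality (Vertex B)
  hub        ≟ᵛ hub          = yes refl
  hub        ≟ᵛ main _ _     = no λ ()
  hub        ≟ᵛ side _ _ _   = no λ ()
  main _ _   ≟ᵛ hub          = no λ ()
  main β d   ≟ᵛ main β′ d′ with β ≟ᴮ β′ | d ≟ d′
  ... | yes refl | yes refl = yes refl
  ... | no β≢    | _        = no λ { refl → β≢ refl }
  ... | _        | no d≢    = no λ { refl → d≢ refl }
  main _ _   ≟ᵛ side _ _ _   = no λ ()
  side _ _ _ ≟ᵛ hub          = no λ ()
  side _ _ _ ≟ᵛ main _ _     = no λ ()
  side β j h ≟ᵛ side β′ j′ h′ with β ≟ᴮ β′ | j ≟ j′ | h ≟ h′
  ... | yes refl | yes refl | yes refl = yes refl
  ... | no β≢    | _        | _        = no λ { refl → β≢ refl }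
  ... | _        | no j≢    | _        = no λ { refl → j≢ refl }
  ... | _        | _        | no h≢    = no λ { refl → h≢ refl }

  marked? : ∀ v → Dec (Marked v)
  marked? hub          = no λ ()
  marked? (main _ _)   = no λ ()
  marked? (side β j h) = suc h ≟ size β j

  up? : ∀ u v → Dec (Up u v)
  up? u v = ¬? (hub? u) ×-dec ((parent u ≟ᵛ v) ⊎-dec (hub? v ×-dec marked? u))

  adj? : ∀ u v → Dec (Adj u v)
  adj? u v = up? u v ⊎-dec up? v u

  adj-sym : ∀ {u v} → Adj u v → Adj v u
  adj-sym (inj₁ a) = inj₂ a
  adj-sym (inj₂ a) = inj₁ a

  adj-irrefl : ∀ v → ¬ Adj v v
  adj-irrefl v = either loop loop
    where
    loop : ¬ Up v v
    loop (v≢ , inj₁ e)       = m≢1+n+m (depth v) {0} (trans (depth-parent v v≢) (cong (λ u → suc (depth u)) e))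
    loop (v≢ , inj₂ (e , _)) = v≢ e

  open InducedGraph Adj adj? adj-irrefl adj-sym

  -- `downFrom` puts every vertex in front of its parent, so that its parent is already present when
  -- it is added.
  sidePath : B → ℕ → List (Vertex B)
  sidePath β j = map (side β j) (downFrom (size β j))

  sidePaths : B → ℕ → List (Vertex B)
  sidePaths β zero    = []
  sidePaths β (suc j) = sidePath β (suc j) ++ sidePaths β j

  mainPath : B → ℕ → List (Vertex B)
  mainPath β s = map (main β) (downFrom s)

  -- `g` bounds from below the gain over a tree, which has one edge fewer than vertices; hence
  -- `suc`.
  record Dense (vs : List (Vertex B)) (g : ℕ) : Set where
    constructor dense
    field
      hub∈  : hub ∈ vs
      bound : length vs + g ≤ suc (edges vs)

  add-vertex : ∀ {vs g} v → v ≢ hub → parent v ∈ vs → Dense vs g → Dense (v ∷ vs) g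
  add-vertex {vs} v v≢ p∈ (dense h b) = dense (there h) (s≤s (≤-trans b
    (+-monoˡ-≤ (edges vs) (degree≥1 {v} (inj₁ (v≢ , inj₁ refl)) p∈))))

  -- The new vertex brings one edge to its parent and one to the hub. These are two edges because
  -- the parent is not the hub.
  add-marked : ∀ {vs g} v → v ≢ hub → parent v ≢ hub → Marked v → parent v ∈ vs → Dense vs g → Dense (v ∷ vs) (suc g)
  add-marked {vs} {g} v v≢ p≢ m p∈ (dense h b) = dense (there h) (s≤s (≤-trans (≤-reflexive (+-suc (length vs) g))
    (≤-trans (s≤s b) (+-monoˡ-≤ (edges vs)
      (degree≥2 {v} p≢ (inj₁ (v≢ , inj₁ refl)) (inj₁ (v≢ , inj₂ (refl , m))) p∈ h)))))

  side-parent∈ : ∀ β j h {vs} → main β (foot β j) ∈ vs → parent (side β j h) ∈ map (side β j) (downFrom h) ++ vs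
  side-parent∈ β j zero    m∈ = m∈
  side-parent∈ β j (suc h) _  = here refl

  add-path : ∀ β j n {vs g} → main β (foot β j) ∈ vs → Dense vs g → Dense (map (side β j) (downFrom n) ++ vs) g
  add-path β j zero    _  d = d
  add-path β j (suc n) m∈ d = add-vertex (side β j n) (λ ()) (side-parent∈ β j n m∈) (add-path β j n m∈ d)

  add-sidePath : ∀ β j {vs g} → 1 ≤ size β j → main β (foot β j) ∈ vs → Dense vs g → Dense (sidePath β j ++ vs) (suc g)
  add-sidePath β j {vs} {g} s m∈ d with size β j in eq
  ... | suc n = add-marked (side β j n) (λ ()) (p≢ n) (sym eq) (side-parent∈ β j n m∈) (add-path β j n m∈ d)
    where
    p≢ : ∀ n → parent (side β j n) ≢ hub
    p≢ zero ()
    p≢ (suc _) ()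

  add-sidePaths : ∀ β J {vs g} → (∀ j → 1 ≤ j → j ≤ J → 1 ≤ size β j × main β (foot β j) ∈ vs) →
    Dense vs g → Dense (sidePaths β J ++ vs) (J + g)
  add-sidePaths β zero    _  d = d
  add-sidePaths β (suc J) {vs} {g} ok d = subst (λ xs → Dense xs (suc J + g)) (sym (++-assoc (sidePath β (suc J)) (sidePaths β J) vs))
    (let s , m∈ = ok (suc J) (s≤s z≤n) ≤-refl in
     add-sidePath β (suc J) s (∈-++⁺ʳ (sidePaths β J) m∈) (add-sidePaths β J (λ j 1≤ j≤ → ok j 1≤ (m≤n⇒m≤1+n j≤)) d))

  add-mainPath : ∀ β n {vs g} → Dense vs g → Dense (mainPath β n ++ vs) g
  add-mainPath β zero          d = d
  add-mainPath β (suc zero)    d = add-vertex (main β 0) (λ ()) (Dense.hub∈ d) d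
  add-mainPath β (suc (suc n)) d = add-vertex (main β (suc n)) (λ ()) (here refl) (add-mainPath β (suc n) d)

  module _ (sideCount spine : B → ℕ) where

    record WellFormed (β : B) : Set where
      field
        foot-mono : ∀ {i j} → j ≤ sideCount β → i ≤ j → foot β i ≤ foot β j
        foot<     : ∀ {j} → 1 ≤ j → j ≤ sideCount β → foot β j < spine β
        size>0    : ∀ {j} → 1 ≤ j → j ≤ sideCount β → 1 ≤ size β j
    open WellFormed

    blockVertices : B → List (Vertex B)
    blockVertices β = sidePaths β (sideCount β) ++ mainPath β (spine β)

    vertices : List B → List (Vertex B)
    vertices []       = hub ∷ []
    vertices (β ∷ βs) = blockVertices β ++ vertices βs

    Block∋ : B → Vertex B → Set
    Block∋ β v = (Σ[ j ∈ ℕ ] Σ[ h ∈ ℕ ] v ≡ side β j h × 1 ≤ j × j ≤ sideCount β) ⊎ (Σ[ d ∈ ℕ ] v ≡ main β d)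

    ∈-sidePath : ∀ {β j v} → v ∈ sidePath β j → Σ[ h ∈ ℕ ] v ≡ side β j h
    ∈-sidePath v∈ = let h , _ , e = ∈-map⁻ _ v∈ in h , e

    ∈-sidePaths : ∀ {β} J {v} → v ∈ sidePaths β J → Σ[ j ∈ ℕ ] Σ[ h ∈ ℕ ] v ≡ side β j h × 1 ≤ j × j ≤ J
    ∈-sidePaths {β} (suc J) v∈ with ∈-++⁻ (sidePath β (suc J)) v∈
    ... | inj₁ ∈₁ = let h , e = ∈-sidePath ∈₁ in suc J , h , e , s≤s z≤n , ≤-refl
    ... | inj₂ ∈₂ = let j , h , e , 1≤ , j≤ = ∈-sidePaths J ∈₂ in j , h , e , 1≤ , m≤n⇒m≤1+n j≤

    ∈-mainPath : ∀ {β s v} → v ∈ mainPath β s → Σ[ d ∈ ℕ ] v ≡ main β d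
    ∈-mainPath v∈ = let d , _ , e = ∈-map⁻ _ v∈ in d , e

    ∈-blockVertices : ∀ {β v} → v ∈ blockVertices β → Block∋ β v
    ∈-blockVertices {β} v∈ = map⊎ (∈-sidePaths (sideCount β)) ∈-mainPath (∈-++⁻ (sidePaths β (sideCount β)) v∈)

    ∈-vertices : ∀ βs {v} → v ∈ vertices βs → v ≡ hub ⊎ (Σ[ β ∈ B ] β ∈ βs × Block∋ β v)
    ∈-vertices []       (here e) = inj₁ e
    ∈-vertices (β ∷ βs) v∈ with ∈-++⁻ (blockVertices β) v∈
    ... | inj₁ ∈₁ = inj₂ (β , here refl , ∈-blockVertices ∈₁)
    ... | inj₂ ∈₂ = map⊎ (λ e → e) (map₂ (map× there (λ b → b))) (∈-vertices βs ∈₂)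

    unique-sidePaths : ∀ β J → Unique (sidePaths β J)
    unique-sidePaths β zero    = []
    unique-sidePaths β (suc J) = Unique.++⁺ (Unique.map⁺ (λ { refl → refl }) (Unique.downFrom⁺ _)) (unique-sidePaths β J)
      λ (∈₁ , ∈₂) → disjoint (∈-sidePath ∈₁) (∈-sidePaths J ∈₂)
      where
      disjoint : ∀ {v} → (Σ[ h ∈ ℕ ] v ≡ side β (suc J) h) → (Σ[ j ∈ ℕ ] Σ[ h ∈ ℕ ] v ≡ side β j h × 1 ≤ j × j ≤ J) → ⊥
      disjoint (_ , refl) (_ , _ , refl , _ , J<) = <-irrefl refl J<

    unique-blockVertices : ∀ β → Unique (blockVertices β)
    unique-blockVertices β = Unique.++⁺ (unique-sidePaths β (sideCount β))
      (Unique.map⁺ (λ { refl → refl }) (Unique.downFrom⁺ _)) λ (∈₁ , ∈₂) → disjoint (∈-sidePaths (sideCount β) ∈₁) (∈-mainPath ∈₂)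
      where
      disjoint : ∀ {J v} → (Σ[ j ∈ ℕ ] Σ[ h ∈ ℕ ] v ≡ side β j h × 1 ≤ j × j ≤ J) → (Σ[ d ∈ ℕ ] v ≡ main β d) → ⊥
      disjoint (_ , _ , refl , _) (_ , ())

    unique-vertices : ∀ {βs} → Unique βs → Unique (vertices βs)
    unique-vertices []                         = [] ∷ []
    unique-vertices {β ∷ βs} u@(_ ∷ us) = Unique.++⁺ (unique-blockVertices β) (unique-vertices us)
      λ (∈₁ , ∈₂) → disjoint (∈-blockVertices ∈₁) (∈-vertices βs ∈₂)
      where
      disjoint : ∀ {v} → Block∋ β v → v ≡ hub ⊎ (Σ[ γ ∈ B ] γ ∈ βs × Block∋ γ v) → ⊥
      disjoint (inj₁ (_ , _ , refl , _)) (inj₁ ())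
      disjoint (inj₂ (_ , refl))         (inj₁ ())
      disjoint (inj₁ (_ , _ , refl , _)) (inj₂ (_ , γ∈ , inj₁ (_ , _ , refl , _))) = Unique.Unique[x∷xs]⇒x∉xs u γ∈
      disjoint (inj₁ (_ , _ , refl , _)) (inj₂ (_ , _ , inj₂ (_ , ())))
      disjoint (inj₂ (_ , refl))         (inj₂ (_ , _ , inj₁ (_ , _ , () , _)))
      disjoint (inj₂ (_ , refl))         (inj₂ (_ , γ∈ , inj₂ (_ , refl))) = Unique.Unique[x∷xs]⇒x∉xs u γ∈

    dense-vertices : ∀ βs → (∀ {β} → β ∈ βs → WellFormed β) → Dense (vertices βs) (sum (map sideCount βs))
    dense-vertices []       _  = dense (here refl) ≤-refl
    dense-vertices (β ∷ βs) wf = subst (λ xs → Dense xs (sum (map sideCount (β ∷ βs))))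
      (sym (++-assoc (sidePaths β (sideCount β)) (mainPath β (spine β)) (vertices βs)))
      (add-sidePaths β (sideCount β) (λ j 1≤ j≤ → size>0 w 1≤ j≤ , ∈-++⁺ˡ (∈-map⁺ (main β) (∈-downFrom⁺ (foot< w 1≤ j≤))))
        (add-mainPath β (spine β) (dense-vertices βs (λ γ∈ → wf (there γ∈)))))
      where
      w = wf (here refl)

    module _ {βs : List B} (unique : Unique βs) (wf : ∀ {β} → β ∈ βs → WellFormed β)
      (lengths : ∀ {β i j β′ i′ j′} → β ∈ βs → β′ ∈ βs → i < j → j ≤ sideCount β → i′ < j′ → j′ ≤ sideCount β′ →
        ∀ L → L + foot β i ≡ 2 + size β i + size β j + foot β j →
        L + foot β′ i′ ≡ 2 + size β′ i′ + size β′ j′ + foot β′ j′ → (β , i , j) ≡ (β′ , i′ , j′)) where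

      private
        G = induced (vertices βs)

        Side : B → ℕ → Set
        Side β j = β ∈ βs × j ≤ sideCount β

        known : ∀ {β j h} → side β j h ∈ vertices βs → Side β j
        known v∈ with ∈-vertices βs v∈
        ... | inj₂ (_ , β∈ , inj₁ (_ , _ , refl , _ , j≤)) = β∈ , j≤
        ... | inj₂ (_ , _  , inj₂ (_ , ()))

      caterpillars-distinct : DistinctCycleLengths G
      caterpillars-distinct = distinct-lengths (unique-vertices unique)
        (same-length Side (λ (β∈ , j≤) → foot-mono (wf β∈) j≤) (_∈ vertices βs) known
          (λ lt (β∈ , j≤) lt′ (β′∈ , j′≤) → lengths β∈ β′∈ lt j≤ lt′ j′≤))

      caterpillars-maximal : ∀ {f : ℕ → ℕ} → (∀ n → IsMaxEdges n (f n)) → ∀ {n} → length (vertices βs) ≡ n →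
        n + sum (map sideCount βs) ≤ suc (f n)
      caterpillars-maximal {f} max refl = ≤-trans (Dense.bound (dense-vertices βs wf))
        (s≤s (≤-trans (≤-reflexive (sym (edgeCount-induced (vertices βs))))
          (proj₂ (max (length (vertices βs))) G caterpillars-distinct)))

-- Families of caterpillars

-- (a , b , c) is the linear form a M + b m + c.
Linear : Set
Linear = ℕ × ℕ × ℕ

-- The foot and the size of each side of a block, as linear forms in m.
Family : Set
Family = List (Linear × Linear)

-- Sides are numbered from 1, since 0 stands for the root of the main path; numbers beyond the list
-- get a default.
sideAt : Family → ℕ → Linear × Linear
sideAt F       zero          = (0 , 0 , 0) , (0 , 0 , 0)
sideAt []      (suc j)       = (0 , 0 , 0) , (0 , 0 , 0)
sideAt (s ∷ F) (suc zero)    = s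
sideAt (s ∷ F) (suc (suc j)) = sideAt F (suc j)

-- A family with the numbers i < j of two sides, hence with one cycle.
Entry : Set
Entry = Family × ℕ × ℕ

entries : List Family → List Entry
entries = concatMap λ F → concatMap (λ j → map (λ i → F , i , j) (upTo j)) (upTo (suc (length F)))

module Layout (width : ℕ) .{{_ : NonZero width}} where

  -- The cycle of x has length width * ((M + 1) * slot x + (m + carry x)) + rest x % width.
  -- As carry x ≤ 1, distinct keys ensure distinct lengths for all m < M.
  slot carry rest : Entry → ℕ
  rest (F , i , j) = let ((_ , _ , f) , (_ , _ , e)) = sideAt F i ; ((_ , _ , f′) , (_ , _ , e′)) = sideAt F j in
    2 + e + e′ + f′ ∸ f
  slot x@(F , i , j) = let ((p , _ , _) , (s , _ , _)) = sideAt F i ; ((p′ , _ , _) , (s′ , _ , _)) = sideAt F j in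
    (s + s′ + p′ ∸ p) / width
  carry x = rest x / width ∸ slot x

  key : Entry → ℕ
  key x = slot x * width + rest x % width

  -- Compares the coefficients of the cycle length at `M`, at `m` and at 1. The coefficient of `m`
  -- is `width`, and the constant term contains a further `width * slot x`, which turns `M * slot x`
  -- into `suc M * slot x`. The equations are additive because the subtractions in `slot` and `rest`
  -- truncate; the inequalities provide monotone feet and nonempty sides.
  Good : Entry → Set
  Good x@(F , i , j) = let ((p , q , f) , (s , t , e)) = sideAt F i ; ((p′ , q′ , f′) , (s′ , t′ , e′)) = sideAt F j in
      (p ≤ p′ × q ≤ q′ × f ≤ f′ × 1 ≤ e′)
    × (s + s′ + p′ ≡ p + width * slot x)
    × (t + t′ + q′ ≡ q + width)
    × (2 + e + e′ + f′ ≡ f + (width * (slot x + carry x) + rest x % width))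
    × carry x ≤ 1

  good? : ∀ x → Dec (Good x)
  good? x@(F , i , j) = let ((p , q , f) , (s , t , e)) = sideAt F i ; ((p′ , q′ , f′) , (s′ , t′ , e′)) = sideAt F j in
    (p ≤? p′ ×-dec q ≤? q′ ×-dec f ≤? f′ ×-dec 1 ≤? e′)
    ×-dec (s + s′ + p′ ≟ p + width * slot x)
    ×-dec (t + t′ + q′ ≟ q + width)
    ×-dec (2 + e + e′ + f′ ≟ f + (width * (slot x + carry x) + rest x % width))
    ×-dec (carry x ≤? 1)

unique-map⇒injective : ∀ {A C : Set} {g : A → C} {xs x y} → Unique (map g xs) → x ∈ xs → y ∈ xs → g x ≡ g y → x ≡ y
unique-map⇒injective (_ ∷ _)  (here refl) (here refl) _ = refl
unique-map⇒injective {g = g} (p ∷ _) (here refl) (there y∈) e = ⊥-elim (All.lookup p (∈-map⁺ g y∈) e)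
unique-map⇒injective {g = g} (p ∷ _) (there x∈) (here refl) e = ⊥-elim (All.lookup p (∈-map⁺ g x∈) (sym e))
unique-map⇒injective (_ ∷ u) (there x∈) (there y∈) e = unique-map⇒injective u x∈ y∈ e

∈-entries : ∀ {families F i j} → F ∈ families → i < j → j ≤ length F → (F , i , j) ∈ entries families
∈-entries {F = F} F∈ i<j j≤ = ∈-concatMap⁺ _ (Any.map (λ { refl → ∈-concatMap⁺ (λ j → map (λ i → F , i , j) (upTo j))
  (Any.map (λ { refl → ∈-map⁺ (λ i → F , i , _) (∈-upTo⁺ i<j) }) (∈-upTo⁺ (s≤s j≤))) }) F∈)

eval : ℕ → ℕ → Linear → ℕ
eval T m (a , b , c) = a * T + b * m + c

infixl 6 _⊕_
_⊕_ : Linear → Linear → Linear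
(a , b , c) ⊕ (a′ , b′ , c′) = a + a′ , b + b′ , c + c′

eval-⊕ : ∀ T m l l′ → eval T m (l ⊕ l′) ≡ eval T m l + eval T m l′
eval-⊕ T m (a , b , c) (a′ , b′ , c′) = lemma a a′ b b′ c c′ T m
  where
  lemma : ∀ a a′ b b′ c c′ T m →
    (a + a′) * T + (b + b′) * m + (c + c′) ≡ (a * T + b * m + c) + (a′ * T + b′ * m + c′)
  lemma = solve-∀

sizes : Family → ℕ → Linear
sizes F zero    = 0 , 0 , 0
sizes F (suc j) = proj₂ (sideAt F (suc j)) ⊕ sizes F j

-- The main path ends at the last foot, and as heights start from 0 it has one vertex more than that
-- height.
order : Family → Linear
order F = sizes F (length F) ⊕ (proj₁ (sideAt F (length F)) ⊕ (0 , 0 , 1))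

totals : List Family → Linear
totals []       = 0 , 0 , 0
totals (F ∷ Fs) = order F ⊕ totals Fs

gain : List Family → ℕ
gain Fs = sum (map length Fs)

series : ℕ → ℕ → Linear → ℕ
series T n l = sum (map (λ m → eval T m l) (downFrom n))

series-⊕ : ∀ T n l l′ → series T n (l ⊕ l′) ≡ series T n l + series T n l′
series-⊕ T zero    l l′ = refl
series-⊕ T (suc n) l l′ = trans (cong₂ _+_ (eval-⊕ T n l l′) (series-⊕ T n l l′))
  (interchange (eval T n l) (eval T n l′) (series T n l) (series T n l′))
  where
  interchange : ∀ a b c d → (a + b) + (c + d) ≡ (a + c) + (b + d)
  interchange = solve-∀

-- The sum of `b * m` over `m < n` is `b * n * (n ∸ 1) / 2`. Doubling removes the division, and
-- `b * n` on the left the subtraction.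
series-closed : ∀ T n a b c → 2 * series T n (a , b , c) + b * n ≡ (2 * (a * T) + b * n + 2 * c) * n
series-closed T zero    a b c = trans (*-zeroʳ b) (sym (*-zeroʳ (2 * (a * T) + b * 0 + 2 * c)))
series-closed T (suc n) a b c = trans (split (a * T) b c n (series T n (a , b , c)))
  (trans (cong (_+ (2 * (a * T) + 2 * (b * n) + 2 * c + b)) (series-closed T n a b c)) (join (a * T) b c n))
  where
  split : ∀ x b c n s → 2 * ((x + b * n + c) + s) + b * suc n ≡ (2 * s + b * n) + (2 * x + 2 * (b * n) + 2 * c + b)
  split = solve-∀
  join : ∀ x b c n → (2 * x + b * n + 2 * c) * n + (2 * x + 2 * (b * n) + 2 * c + b) ≡ (2 * x + b * suc n + 2 * c) * suc n
  join = solve-∀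

sum-product : ∀ {A C : Set} (g : A × C → ℕ) xs (ys : List C) →
  sum (map g (cartesianProduct xs ys)) ≡ sum (map (λ x → sum (map (λ y → g (x , y)) ys)) xs)
sum-product g []       ys = refl
sum-product g (x ∷ xs) ys = trans (cong sum (map-++ g (map (x ,_) ys) (cartesianProduct xs ys)))
  (trans (sum-++ (map g (map (x ,_) ys)) _) (cong₂ _+_ (cong sum (sym (map-∘ ys))) (sum-product g xs ys)))

divMod-unique : ∀ n q r q′ r′ → r < n → r′ < n → n * q + r ≡ n * q′ + r′ → q ≡ q′ × r ≡ r′
divMod-unique n q r q′ r′ r<n r′<n e = q≡ , +-cancelˡ-≡ (n * q) r r′ (trans e (cong (λ x → n * x + r′) (sym q≡)))
  where
  below : ∀ q r q′ r′ → r′ < n → n * q + r ≡ n * q′ + r′ → ¬ (q′ < q)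
  below q r q′ r′ r′<n e q′<q = <-irrefl (sym e) (begin-strict
    n * q′ + r′   <⟨ +-monoʳ-< (n * q′) r′<n ⟩
    n * q′ + n    ≡⟨ trans (+-comm (n * q′) n) (sym (*-suc n q′)) ⟩
    n * suc q′    ≤⟨ *-monoʳ-≤ n q′<q ⟩
    n * q         ≤⟨ m≤m+n (n * q) r ⟩
    n * q + r     ∎)
    where open ≤-Reasoning
  q≡ : q ≡ q′
  q≡ = ≤-antisym (≮⇒≥ (below q r q′ r′ r′<n e)) (≮⇒≥ (below q′ r′ q r r<n (sym e)))

_≟ˡ_ : DecidableEquality Linear
_≟ˡ_ = ×-≡-dec _≟_ (×-≡-dec _≟_ _≟_)

Block : Set
Block = Family × ℕ

_≟ᵇ_ : DecidableEquality Block
_≟ᵇ_ = ×-≡-dec (List-≡-dec (×-≡-dec _≟ˡ_ _≟ˡ_)) _≟_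

sides : Block → ℕ
sides (F , _) = length F

-- The graph formed by all families for a given `M`

module Construction (width : ℕ) .{{_ : NonZero width}} (families : List Family) (M : ℕ)
  (all-good : All (Layout.Good width) (entries families)) (keys-unique : Unique (map (Layout.key width) (entries families)))
  (roots-unique : Unique (map (λ F → Layout.key width (F , 0 , 1)) families))
  (families-nonempty : All (λ F → 1 ≤ length F) families) where
  open Layout width

  foot size : Block → ℕ → ℕ
  foot (F , m) j = eval M m (proj₁ (sideAt F j))
  size (F , m) j = eval M m (proj₂ (sideAt F j))

  -- The block of the empty family is a bare path, which absorbs the superfluous vertices.
  spine : Block → ℕ
  spine ([] , m)          = m
  spine β@(F@(_ ∷ _) , _) = suc (foot β (length F))

  open CaterpillarGraph _≟ᵇ_ foot size (λ _ → refl) (λ _ → refl)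

  length-good : ∀ F i j m L → let x = F , i , j in Good x →
    L + foot (F , m) i ≡ 2 + size (F , m) i + size (F , m) j + foot (F , m) j →
    L ≡ width * (suc M * slot x + (m + carry x)) + rest x % width
  length-good F i j m L (_ , es , et , ec , _) e =
    +-cancelʳ-≡ (foot (F , m) i) L _ (trans e (begin
      2 + size (F , m) i + size (F , m) j + foot (F , m) j
        ≡⟨ gather s s′ p′ t t′ q′ _ _ _ M m ⟩
      (s + s′ + p′) * M + (t + t′ + q′) * m + (2 + c + c′ + f′)
        ≡⟨ cong₂ _+_ (cong₂ _+_ (cong (_* M) es) (cong (_* m) et)) ec ⟩
      (p + width * slot x) * M + (q + width) * m + (f + (width * (slot x + carry x) + rest x % width))
        ≡⟨ spread p q f width (slot x) (carry x) (rest x % width) M m ⟩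
      width * (suc M * slot x + (m + carry x)) + rest x % width + foot (F , m) i ∎))
    where
    open ≡-Reasoning
    x : Entry
    x = F , i , j
    s = proj₁ (proj₂ (sideAt F i)) ; t = proj₁ (proj₂ (proj₂ (sideAt F i))) ; c = proj₂ (proj₂ (proj₂ (sideAt F i)))
    s′ = proj₁ (proj₂ (sideAt F j)) ; t′ = proj₁ (proj₂ (proj₂ (sideAt F j))) ; c′ = proj₂ (proj₂ (proj₂ (sideAt F j)))
    p = proj₁ (proj₁ (sideAt F i)) ; q = proj₁ (proj₂ (proj₁ (sideAt F i))) ; f = proj₂ (proj₂ (proj₁ (sideAt F i)))
    p′ = proj₁ (proj₁ (sideAt F j)) ; q′ = proj₁ (proj₂ (proj₁ (sideAt F j))) ; f′ = proj₂ (proj₂ (proj₁ (sideAt F j)))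
    gather : ∀ s s′ p′ t t′ q′ c c′ f′ M m →
      2 + (s * M + t * m + c) + (s′ * M + t′ * m + c′) + (p′ * M + q′ * m + f′)
        ≡ (s + s′ + p′) * M + (t + t′ + q′) * m + (2 + c + c′ + f′)
    gather = solve-∀
    spread : ∀ p q f w k c r M m →
      (p + w * k) * M + (q + w) * m + (f + (w * (k + c) + r))
        ≡ w * (suc M * k + (m + c)) + r + (p * M + q * m + f)
    spread = solve-∀

  good : ∀ {F i j} → F ∈ families → i < j → j ≤ length F → Good (F , i , j)
  good F∈ i<j j≤ = All.lookup all-good (∈-entries F∈ i<j j≤)

  -- Two divisions decode a length: by `width` into the residue and a quotient, and that quotient by
  -- `suc M` into the slot and `m + carry`. Slot and residue form the key, the key determines the
  -- entry, the entry its carry, and this leaves `m`.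
  lengths-injective : ∀ {F m i j F′ m′ i′ j′} → F ∈ families → m < M → F′ ∈ families → m′ < M →
    i < j → j ≤ length F → i′ < j′ → j′ ≤ length F′ → ∀ L →
    L + foot (F , m) i ≡ 2 + size (F , m) i + size (F , m) j + foot (F , m) j →
    L + foot (F′ , m′) i′ ≡ 2 + size (F′ , m′) i′ + size (F′ , m′) j′ + foot (F′ , m′) j′ →
    ((F , m) , i , j) ≡ ((F′ , m′) , i′ , j′)
  lengths-injective {F} {m} {i} {j} {F′} {m′} {i′} {j′} F∈ m<M F′∈ m′<M i<j j≤ i′<j′ j′≤ L e e′ =
    finish (unique-map⇒injective keys-unique (∈-entries F∈ i<j j≤) (∈-entries F′∈ i′<j′ j′≤)
             (cong₂ (λ k r → k * width + r) (proj₁ inner) (proj₂ outer))) (proj₂ inner)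
    where
    x = (F , i , j)
    y = (F′ , i′ , j′)
    gx = good F∈ i<j j≤
    gy = good F′∈ i′<j′ j′≤
    outer : suc M * slot x + (m + carry x) ≡ suc M * slot y + (m′ + carry y) × rest x % width ≡ rest y % width
    outer = divMod-unique width _ _ _ _ (m%n<n (rest x) width) (m%n<n (rest y) width)
      (trans (sym (length-good F i j m L gx e)) (length-good F′ i′ j′ m′ L gy e′))
    -- A carry can push `m` up to `M`, which is why an interval has `suc M` places for each residue.
    small : ∀ {m} z → m < M → Good z → m + carry z < suc M
    small {m} z m<M (_ , _ , _ , _ , c≤1) = s≤s (≤-trans (+-monoʳ-≤ m c≤1) (≤-trans (≤-reflexive (+-comm m 1)) m<M))
    inner : slot x ≡ slot y × m + carry x ≡ m′ + carry y
    inner = divMod-unique (suc M) _ _ _ _ (small x m<M gx) (small y m′<M gy) (proj₁ outer)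
    finish : x ≡ y → m + carry x ≡ m′ + carry y → ((F , m) , i , j) ≡ ((F′ , m′) , i′ , j′)
    finish refl e″ = cong (λ n → (F , n) , i , j) (+-cancelʳ-≡ (carry x) m m′ e″)

  blocks : ℕ → List Block
  blocks p = ([] , p) ∷ cartesianProduct families (downFrom M)

  ∈-blocks : ∀ {p β} → β ∈ blocks p → sides β ≡ 0 ⊎ (proj₁ β ∈ families × proj₂ β < M)
  ∈-blocks (here refl) = inj₁ refl
  ∈-blocks (there β∈)  = let F∈ , m∈ = ∈-cartesianProduct⁻ families (downFrom M) β∈ in inj₂ (F∈ , ∈-downFrom⁻ m∈)

  well-formed : ∀ {F m} → F ∈ families → m < M → WellFormed sides spine (F , m)
  well-formed {F@(_ ∷ _)} {m} F∈ m<M = record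
    { foot-mono = mono
    ; foot<     = λ 1≤ j≤ → s≤s (mono ≤-refl j≤)
    ; size>0    = λ 1≤ j≤ → ≤-trans (proj₂ (proj₂ (proj₂ (proj₁ (good F∈ 1≤ j≤))))) (m≤n+m _ _)
    }
    where
    mono : ∀ {i j} → j ≤ length F → i ≤ j → foot (F , m) i ≤ foot (F , m) j
    mono j≤ i≤j with m≤n⇒m<n∨m≡n i≤j
    ... | inj₂ refl = ≤-refl
    ... | inj₁ i<j  = let (p , q , f , _) , _ = good F∈ i<j j≤ in
      +-mono-≤ (+-mono-≤ (*-monoˡ-≤ M p) (*-monoˡ-≤ m q)) f
  well-formed {[]} F∈ m<M with () ← All.lookup families-nonempty F∈

  well-formed-blocks : ∀ {p β} → β ∈ blocks p → WellFormed sides spine β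
  well-formed-blocks {β = [] , m} β∈ = record { foot-mono = λ { z≤n z≤n → ≤-refl } ; foot< = λ { (s≤s _) () } ; size>0 = λ { (s≤s _) () } }
  well-formed-blocks {β = _ ∷ _ , m} β∈ with ∈-blocks β∈
  ... | inj₂ (F∈ , m<M) = well-formed F∈ m<M

  unique-blocks : ∀ p → Unique (blocks p)
  unique-blocks p = All.tabulate (λ β∈ → λ { refl → nonempty (proj₁ (∈-cartesianProduct⁻ families (downFrom M) β∈)) })
    ∷ Unique.cartesianProduct⁺ (Unique.map⁻ roots-unique) (Unique.downFrom⁺ M)
    where
    nonempty : ¬ [] ∈ families
    nonempty F∈ with () ← All.lookup families-nonempty F∈

  block-lengths : ∀ {p β i j β′ i′ j′} → β ∈ blocks p → β′ ∈ blocks p → i < j → j ≤ sides β → i′ < j′ → j′ ≤ sides β′ →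
    ∀ L → L + foot β i ≡ 2 + size β i + size β j + foot β j →
    L + foot β′ i′ ≡ 2 + size β′ i′ + size β′ j′ + foot β′ j′ → (β , i , j) ≡ (β′ , i′ , j′)
  block-lengths β∈ β′∈ i<j j≤ i′<j′ j′≤ with ∈-blocks β∈ | ∈-blocks β′∈
  ... | inj₁ e | _ = ⊥-elim (n≮0 (subst (_ <_) e (≤-trans i<j j≤)))
  ... | _ | inj₁ e = ⊥-elim (n≮0 (subst (_ <_) e (≤-trans i′<j′ j′≤)))
  ... | inj₂ (F∈ , m<) | inj₂ (F′∈ , m′<) = lengths-injective F∈ m< F′∈ m′< i<j j≤ i′<j′ j′≤

  length-sidePaths : ∀ F m j → length (sidePaths (F , m) j) ≡ eval M m (sizes F j)
  length-sidePaths F m zero    = refl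
  length-sidePaths F m (suc j) = trans (length-++ (sidePath (F , m) (suc j)))
    (trans (cong₂ _+_ (trans (length-map _ (downFrom (size (F , m) (suc j)))) (length-downFrom (size (F , m) (suc j)))) (length-sidePaths F m j))
           (sym (eval-⊕ M m (proj₂ (sideAt F (suc j))) (sizes F j))))

  length-block : ∀ F m → F ≢ [] → length (blockVertices sides spine (F , m)) ≡ eval M m (order F)
  length-block []        m F≢ = ⊥-elim (F≢ refl)
  length-block F@(_ ∷ _) m _  = trans (length-++ (sidePaths (F , m) (length F)))
    (trans (cong₂ _+_ (length-sidePaths F m (length F))
       (trans (length-map _ (downFrom (suc (foot (F , m) (length F))))) (trans (length-downFrom (suc (foot (F , m) (length F))))
         (trans (+-comm 1 (foot (F , m) (length F))) (sym (eval-⊕ M m (proj₁ (sideAt F (length F))) (0 , 0 , 1)))))))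
      (sym (eval-⊕ M m (sizes F (length F)) _)))

  length-vertices : ∀ βs → length (vertices sides spine βs) ≡ suc (sum (map (λ β → length (blockVertices sides spine β)) βs))
  length-vertices []       = refl
  length-vertices (β ∷ βs) = trans (length-++ (blockVertices sides spine β)) (trans (cong (length (blockVertices sides spine β) +_) (length-vertices βs)) (+-suc _ _))

  sum-orders : ∀ Fs → All (λ F → 1 ≤ length F) Fs →
    sum (map (λ F → sum (map (λ m → length (blockVertices sides spine (F , m))) (downFrom M))) Fs) ≡ series M M (totals Fs)
  sum-orders []       _ = sym (series-zero M)
    where
    series-zero : ∀ n → series M n (0 , 0 , 0) ≡ 0
    series-zero zero    = refl
    series-zero (suc n) = series-zero n
  sum-orders (F ∷ Fs) (ne ∷ nes) = trans (cong₂ _+_ (orders (downFrom M)) (sum-orders Fs nes)) (sym (series-⊕ M M (order F) (totals Fs)))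
    where
    orders : ∀ ms → sum (map (λ m → length (blockVertices sides spine (F , m))) ms) ≡ sum (map (λ m → eval M m (order F)) ms)
    orders []       = refl
    orders (m ∷ ms) = cong₂ _+_ (length-block F m (λ { refl → n≮0 ne })) (orders ms)

  sum-sides : ∀ Fs → sum (map (λ F → sum (map (λ m → length F) (downFrom M))) Fs) ≡ M * gain Fs
  sum-sides []       = sym (*-zeroʳ M)
  sum-sides (F ∷ Fs) = trans (cong₂ _+_ (constant M) (sum-sides Fs)) (sym (*-distribˡ-+ M (length F) (gain Fs)))
    where
    constant : ∀ n → sum (map (λ m → length F) (downFrom n)) ≡ n * length F
    constant zero    = refl
    constant (suc n) = cong (length F +_) (constant n)

  length-blocks : ∀ p → length (vertices sides spine (blocks p)) ≡ suc (p + series M M (totals families))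
  length-blocks p = trans (length-vertices (blocks p)) (cong suc (cong₂ _+_
    (trans (length-map (main ([] , p)) (downFrom p)) (length-downFrom p))
    (trans (sum-product (λ β → length (blockVertices sides spine β)) families (downFrom M)) (sum-orders families families-nonempty))))

  many-edges : ∀ {g a b c} → gain families ≡ g → totals families ≡ (a , b , c) →
    ∀ {f : ℕ → ℕ} → (∀ n → IsMaxEdges n (f n)) → ∀ {n} → suc (series M M (a , b , c)) ≤ n → n + M * g ≤ suc (f n)
  many-edges refl refl {f} max {n} V≤n = subst (λ g → n + g ≤ suc (f n))
    (trans (sum-product sides families (downFrom M)) (sum-sides families))
    (caterpillars-maximal sides spine (unique-blocks p) well-formed-blocks block-lengths max
      (trans (length-blocks p) (trans (sym (+-suc p _)) (m∸n+n≡m V≤n))))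
    where
    p = n ∸ suc (series M M (totals families))

-- The design

-- A Boolean test, since evaluating unique? on the 1382 keys would build large proof terms.
avoids : ℕ → List ℕ → Bool
avoids x []       = true
avoids x (y ∷ ys) with x ≡ᵇ y
... | true  = false
... | false = avoids x ys

distinct : List ℕ → Bool
distinct []       = true
distinct (x ∷ xs) with avoids x xs
... | true  = distinct xs
... | false = false

avoids-sound : ∀ x ys → T (avoids x ys) → All (x ≢_) ys
avoids-sound x []       _ = []
avoids-sound x (y ∷ ys) p with x ≡ᵇ y in e
... | false = (λ x≡y → subst T e (≡⇒≡ᵇ x y x≡y)) ∷ avoids-sound x ys p

distinct-sound : ∀ xs → T (distinct xs) → Unique xs
distinct-sound []       _ = []
distinct-sound (x ∷ xs) p with avoids x xs in e
... | true = avoids-sound x xs (subst T (sym e) tt) ∷ distinct-sound xs p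

-- (p , f , s , e) is a side with foot 32 (p M + m) + f and size 32 (s M + m) + e.
fanData : List (List (ℕ × ℕ × ℕ × ℕ))
fanData =
    ((7 , 236 , 7 , 269) ∷ (15 , 450 , 9 , 321) ∷ (21 , 667 , 7 , 245) ∷ (29 , 929 , 9 , 340) ∷ (31 , 977 , 9 , 303) ∷ (31 , 977 , 9 , 319) ∷ [])
  ∷ ((7 , 237 , 7 , 231) ∷ (15 , 494 , 9 , 317) ∷ (21 , 668 , 7 , 247) ∷ (29 , 928 , 9 , 299) ∷ (31 , 994 , 9 , 345) ∷ (31 , 994 , 9 , 315) ∷ [])
  ∷ ((7 , 285 , 7 , 227) ∷ (11 , 393 , 9 , 322) ∷ (19 , 661 , 7 , 282) ∷ (25 , 858 , 9 , 326) ∷ (31 , 1047 , 7 , 259) ∷ (31 , 1047 , 7 , 278) ∷ [])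
  ∷ ((8 , 226 , 8 , 286) ∷ (12 , 379 , 8 , 265) ∷ (20 , 647 , 10 , 345) ∷ (28 , 905 , 8 , 294) ∷ (34 , 1078 , 8 , 298) ∷ (36 , 1151 , 6 , 204) ∷ [])
  ∷ ((8 , 229 , 8 , 291) ∷ (12 , 386 , 8 , 313) ∷ (20 , 614 , 10 , 349) ∷ (28 , 897 , 8 , 303) ∷ (34 , 1110 , 8 , 283) ∷ (36 , 1151 , 6 , 192) ∷ [])
  ∷ ((8 , 234 , 8 , 290) ∷ (12 , 355 , 8 , 283) ∷ (20 , 624 , 10 , 341) ∷ (28 , 881 , 8 , 291) ∷ (34 , 1101 , 8 , 285) ∷ (36 , 1151 , 6 , 199) ∷ [])
  ∷ ((8 , 234 , 8 , 292) ∷ (12 , 371 , 8 , 297) ∷ (20 , 627 , 10 , 359) ∷ (28 , 884 , 8 , 271) ∷ (34 , 1112 , 8 , 286) ∷ (36 , 1151 , 6 , 223) ∷ [])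
  ∷ ((8 , 239 , 8 , 302) ∷ (12 , 395 , 8 , 292) ∷ (20 , 648 , 10 , 336) ∷ (28 , 879 , 8 , 283) ∷ (34 , 1087 , 8 , 309) ∷ (36 , 1151 , 6 , 195) ∷ [])
  ∷ ((8 , 244 , 8 , 305) ∷ (14 , 457 , 10 , 334) ∷ (20 , 627 , 8 , 286) ∷ (26 , 827 , 10 , 323) ∷ (32 , 999 , 8 , 290) ∷ (34 , 1087 , 6 , 251) ∷ [])
  ∷ ((8 , 245 , 8 , 299) ∷ (14 , 444 , 10 , 358) ∷ (20 , 638 , 8 , 292) ∷ (26 , 834 , 10 , 370) ∷ (32 , 1030 , 8 , 265) ∷ (34 , 1087 , 6 , 191) ∷ [])
  ∷ ((8 , 247 , 8 , 303) ∷ (12 , 390 , 8 , 311) ∷ (20 , 656 , 10 , 351) ∷ (28 , 886 , 8 , 279) ∷ (34 , 1073 , 8 , 304) ∷ (36 , 1151 , 6 , 224) ∷ [])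
  ∷ ((8 , 256 , 8 , 291) ∷ (14 , 458 , 10 , 345) ∷ (20 , 656 , 8 , 279) ∷ (26 , 830 , 10 , 375) ∷ (32 , 1013 , 8 , 303) ∷ (34 , 1087 , 6 , 253) ∷ [])
  ∷ ((8 , 257 , 8 , 265) ∷ (12 , 393 , 8 , 265) ∷ (20 , 655 , 10 , 340) ∷ (28 , 884 , 8 , 299) ∷ (34 , 1087 , 8 , 276) ∷ (36 , 1151 , 6 , 193) ∷ [])
  ∷ ((8 , 257 , 8 , 296) ∷ (14 , 447 , 10 , 334) ∷ (20 , 650 , 8 , 275) ∷ (26 , 840 , 10 , 372) ∷ (32 , 1014 , 8 , 283) ∷ (34 , 1087 , 6 , 205) ∷ [])
  ∷ ((8 , 259 , 8 , 298) ∷ (14 , 467 , 8 , 275) ∷ (20 , 627 , 10 , 354) ∷ (24 , 736 , 10 , 350) ∷ (32 , 1035 , 8 , 272) ∷ (36 , 1151 , 4 , 164) ∷ [])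
  ∷ ((8 , 264 , 8 , 308) ∷ (12 , 381 , 8 , 289) ∷ (20 , 628 , 10 , 347) ∷ (28 , 898 , 8 , 290) ∷ (34 , 1110 , 8 , 292) ∷ (36 , 1151 , 6 , 205) ∷ [])
  ∷ ((8 , 272 , 8 , 286) ∷ (14 , 447 , 8 , 308) ∷ (20 , 636 , 10 , 335) ∷ (24 , 769 , 10 , 372) ∷ (32 , 1011 , 8 , 280) ∷ (36 , 1151 , 4 , 147) ∷ [])
  ∷ ((8 , 273 , 8 , 291) ∷ (12 , 376 , 8 , 296) ∷ (20 , 665 , 10 , 345) ∷ (28 , 873 , 8 , 294) ∷ (34 , 1092 , 8 , 274) ∷ (36 , 1151 , 6 , 248) ∷ [])
  ∷ ((8 , 277 , 8 , 283) ∷ (12 , 370 , 8 , 271) ∷ (20 , 641 , 10 , 335) ∷ (28 , 909 , 8 , 292) ∷ (34 , 1078 , 8 , 305) ∷ (36 , 1151 , 6 , 237) ∷ [])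
  ∷ ((8 , 283 , 8 , 286) ∷ (12 , 375 , 8 , 310) ∷ (20 , 651 , 10 , 354) ∷ (28 , 869 , 8 , 284) ∷ (34 , 1092 , 8 , 270) ∷ (36 , 1151 , 6 , 250) ∷ [])
  ∷ ((8 , 314 , 8 , 260) ∷ (14 , 520 , 6 , 226) ∷ (20 , 681 , 8 , 287) ∷ (30 , 1019 , 8 , 308) ∷ (34 , 1140 , 8 , 311) ∷ (38 , 1247 , 4 , 164) ∷ [])
  ∷ ((9 , 290 , 9 , 288) ∷ (13 , 410 , 9 , 301) ∷ (19 , 601 , 9 , 335) ∷ (25 , 797 , 9 , 334) ∷ (29 , 939 , 9 , 314) ∷ (29 , 939 , 9 , 278) ∷ [])
  ∷ ((9 , 293 , 9 , 332) ∷ (13 , 435 , 7 , 263) ∷ (19 , 591 , 11 , 396) ∷ (27 , 889 , 7 , 254) ∷ (31 , 989 , 9 , 313) ∷ (33 , 1055 , 7 , 251) ∷ [])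
  ∷ ((9 , 295 , 9 , 306) ∷ (11 , 350 , 9 , 345) ∷ (19 , 594 , 9 , 337) ∷ (27 , 861 , 9 , 309) ∷ (31 , 991 , 7 , 286) ∷ (33 , 1055 , 5 , 216) ∷ [])
  ∷ ((9 , 296 , 9 , 299) ∷ (13 , 396 , 7 , 249) ∷ (19 , 602 , 11 , 404) ∷ (27 , 864 , 7 , 230) ∷ (31 , 987 , 9 , 331) ∷ (33 , 1055 , 7 , 268) ∷ [])
  ∷ ((9 , 298 , 9 , 334) ∷ (15 , 472 , 11 , 372) ∷ (19 , 601 , 9 , 315) ∷ (25 , 813 , 9 , 324) ∷ (29 , 933 , 9 , 314) ∷ (29 , 933 , 9 , 307) ∷ [])
  ∷ ((9 , 299 , 9 , 290) ∷ (13 , 406 , 9 , 337) ∷ (19 , 607 , 9 , 298) ∷ (25 , 811 , 9 , 337) ∷ (29 , 948 , 9 , 327) ∷ (29 , 948 , 9 , 289) ∷ [])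
  ∷ ((9 , 299 , 9 , 313) ∷ (13 , 409 , 7 , 255) ∷ (19 , 598 , 11 , 379) ∷ (27 , 856 , 7 , 265) ∷ (31 , 983 , 9 , 337) ∷ (33 , 1055 , 7 , 259) ∷ [])
  ∷ ((9 , 300 , 9 , 294) ∷ (15 , 466 , 11 , 393) ∷ (19 , 612 , 7 , 228) ∷ (27 , 854 , 7 , 257) ∷ (33 , 1075 , 7 , 255) ∷ (33 , 1075 , 7 , 235) ∷ [])
  ∷ ((10 , 320 , 10 , 334) ∷ (12 , 368 , 10 , 363) ∷ (20 , 644 , 14 , 455) ∷ (26 , 816 , 8 , 294) ∷ (30 , 962 , 10 , 346) ∷ (34 , 1087 , 6 , 192) ∷ [])
  ∷ ((5 , 178 , 7 , 255) ∷ (15 , 472 , 9 , 306) ∷ (21 , 680 , 11 , 389) ∷ (27 , 856 , 9 , 321) ∷ (29 , 927 , 7 , 255) ∷ [])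
  ∷ ((6 , 177 , 6 , 235) ∷ (16 , 510 , 6 , 214) ∷ (24 , 761 , 8 , 307) ∷ (34 , 1089 , 8 , 265) ∷ (34 , 1089 , 8 , 290) ∷ [])
  ∷ ((7 , 244 , 7 , 250) ∷ (13 , 393 , 13 , 452) ∷ (21 , 669 , 5 , 177) ∷ (33 , 1062 , 9 , 302) ∷ (33 , 1062 , 7 , 226) ∷ [])
  ∷ ((8 , 228 , 4 , 162) ∷ (16 , 517 , 8 , 269) ∷ (22 , 700 , 10 , 325) ∷ (34 , 1093 , 6 , 226) ∷ (36 , 1151 , 4 , 148) ∷ [])
  ∷ ((8 , 276 , 8 , 295) ∷ (16 , 512 , 8 , 286) ∷ (22 , 699 , 8 , 280) ∷ (30 , 942 , 8 , 284) ∷ (32 , 1023 , 6 , 226) ∷ [])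
  ∷ ((9 , 267 , 9 , 309) ∷ (13 , 423 , 9 , 324) ∷ (21 , 666 , 7 , 232) ∷ (29 , 939 , 7 , 257) ∷ (29 , 939 , 9 , 313) ∷ [])
  ∷ ((9 , 290 , 9 , 338) ∷ (15 , 493 , 9 , 307) ∷ (23 , 755 , 7 , 257) ∷ (27 , 870 , 9 , 305) ∷ (31 , 991 , 5 , 167) ∷ [])
  ∷ ((9 , 341 , 9 , 298) ∷ (13 , 459 , 7 , 280) ∷ (23 , 785 , 9 , 331) ∷ (29 , 946 , 5 , 224) ∷ (35 , 1151 , 3 , 136) ∷ [])
  ∷ ((10 , 378 , 8 , 271) ∷ (20 , 687 , 8 , 295) ∷ (26 , 865 , 6 , 244) ∷ (32 , 1062 , 8 , 302) ∷ (32 , 1062 , 10 , 362) ∷ [])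
  ∷ ((11 , 355 , 5 , 166) ∷ (19 , 638 , 7 , 254) ∷ (27 , 840 , 7 , 260) ∷ (31 , 1013 , 9 , 314) ∷ (33 , 1055 , 7 , 270) ∷ [])
  ∷ ((12 , 374 , 10 , 359) ∷ (16 , 516 , 8 , 309) ∷ (22 , 680 , 14 , 480) ∷ (30 , 975 , 8 , 290) ∷ (30 , 975 , 8 , 256) ∷ [])
  ∷ ((9 , 294 , 3 , 129) ∷ (19 , 604 , 9 , 325) ∷ (29 , 935 , 7 , 243) ∷ (29 , 935 , 5 , 187) ∷ [])
  ∷ ((6 , 173 , 6 , 227) ∷ (18 , 568 , 10 , 333) ∷ (26 , 831 , 4 , 183) ∷ [])
  ∷ ((9 , 295 , 13 , 425) ∷ (11 , 330 , 11 , 382) ∷ (13 , 415 , 9 , 325) ∷ [])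
  ∷ ((11 , 344 , 1 , 69) ∷ (31 , 1014 , 3 , 135) ∷ (31 , 1014 , 7 , 244) ∷ [])
  ∷ ((4 , 127 , 8 , 308) ∷ (12 , 383 , 0 , 36) ∷ [])
  ∷ ((5 , 149 , 5 , 169) ∷ (11 , 351 , 7 , 228) ∷ [])
  ∷ ((8 , 255 , 6 , 238) ∷ (8 , 255 , 8 , 304) ∷ [])
  ∷ ((8 , 256 , 6 , 221) ∷ (8 , 256 , 8 , 283) ∷ [])
  ∷ ((8 , 257 , 6 , 208) ∷ (8 , 257 , 8 , 306) ∷ [])
  ∷ ((8 , 259 , 6 , 238) ∷ (8 , 259 , 8 , 284) ∷ [])
  ∷ ((8 , 261 , 6 , 234) ∷ (8 , 261 , 8 , 269) ∷ [])
  ∷ ((8 , 261 , 6 , 238) ∷ (8 , 261 , 8 , 262) ∷ [])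
  ∷ ((8 , 263 , 8 , 268) ∷ (12 , 383 , 4 , 149) ∷ [])
  ∷ ((8 , 264 , 6 , 191) ∷ (8 , 264 , 8 , 290) ∷ [])
  ∷ ((8 , 269 , 6 , 201) ∷ (8 , 269 , 8 , 260) ∷ [])
  ∷ ((8 , 272 , 6 , 195) ∷ (8 , 272 , 8 , 290) ∷ [])
  ∷ ((8 , 274 , 6 , 172) ∷ (8 , 274 , 8 , 299) ∷ [])
  ∷ ((8 , 274 , 6 , 205) ∷ (8 , 274 , 8 , 282) ∷ [])
  ∷ ((8 , 279 , 6 , 213) ∷ (8 , 279 , 8 , 261) ∷ [])
  ∷ ((8 , 311 , 6 , 215) ∷ (8 , 311 , 8 , 267) ∷ [])
  ∷ ((8 , 315 , 6 , 212) ∷ (8 , 315 , 8 , 294) ∷ [])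
  ∷ ((8 , 315 , 6 , 240) ∷ (8 , 315 , 8 , 268) ∷ [])
  ∷ ((8 , 316 , 6 , 201) ∷ (8 , 316 , 8 , 283) ∷ [])
  ∷ ((8 , 317 , 6 , 235) ∷ (8 , 317 , 8 , 272) ∷ [])
  ∷ ((9 , 265 , 9 , 309) ∷ (11 , 351 , 7 , 255) ∷ [])
  ∷ ((9 , 276 , 9 , 312) ∷ (11 , 351 , 7 , 267) ∷ [])
  ∷ ((9 , 280 , 9 , 307) ∷ (11 , 351 , 7 , 258) ∷ [])
  ∷ ((9 , 288 , 5 , 192) ∷ (11 , 351 , 7 , 269) ∷ [])
  ∷ ((9 , 288 , 9 , 326) ∷ (11 , 351 , 7 , 256) ∷ [])
  ∷ ((9 , 289 , 5 , 180) ∷ (11 , 351 , 7 , 278) ∷ [])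
  ∷ ((9 , 289 , 5 , 197) ∷ (11 , 351 , 7 , 280) ∷ [])
  ∷ ((9 , 291 , 9 , 343) ∷ (11 , 351 , 7 , 266) ∷ [])
  ∷ ((9 , 293 , 9 , 322) ∷ (11 , 351 , 7 , 268) ∷ [])
  ∷ ((9 , 295 , 5 , 177) ∷ (11 , 351 , 7 , 231) ∷ [])
  ∷ ((9 , 295 , 9 , 313) ∷ (11 , 351 , 7 , 286) ∷ [])
  ∷ ((9 , 301 , 5 , 175) ∷ (11 , 351 , 7 , 226) ∷ [])
  ∷ ((9 , 302 , 5 , 145) ∷ (11 , 351 , 7 , 260) ∷ [])
  ∷ ((9 , 302 , 5 , 181) ∷ (11 , 351 , 7 , 229) ∷ [])
  ∷ ((9 , 309 , 9 , 318) ∷ (11 , 351 , 7 , 273) ∷ [])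
  ∷ ((9 , 312 , 9 , 323) ∷ (11 , 351 , 7 , 251) ∷ [])
  ∷ ((9 , 318 , 5 , 178) ∷ (11 , 351 , 7 , 246) ∷ [])
  ∷ ((9 , 347 , 5 , 169) ∷ (11 , 383 , 7 , 304) ∷ [])
  ∷ ((9 , 347 , 5 , 183) ∷ (11 , 383 , 7 , 279) ∷ [])
  ∷ ((9 , 349 , 5 , 164) ∷ (11 , 383 , 7 , 291) ∷ [])
  ∷ ((12 , 404 , 12 , 415) ∷ (20 , 639 , 4 , 143) ∷ [])
  ∷ []

-- The slots among the first 7 intervals that fans occupy; all others carry single cycles.
usedShort : List ℕ
usedShort = 320 ∷ 381 ∷ 392 ∷ 402 ∷ 414 ∷ 415 ∷ 421 ∷ 425 ∷ 432 ∷ 434 ∷ 435 ∷ 437 ∷ []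

-- In a fan every foot and size of a listed side grows at rate `half` in `m`. For two such sides the
-- feet cancel and the sizes add up to `width`; for the root, with foot and size 0, the other side's
-- foot and size do. `cutoff` is `7 * width`.
width half cutoff : ℕ
half   = 32
width  = 64
cutoff = 448

fan : List (ℕ × ℕ × ℕ × ℕ) → Family
fan = map λ (p , f , s , e) → (half * p , half , f) , (half * s , half , e)

-- The cycle has two vertices more than its side, so its constant term is `width + x`. The key is
-- thus `x` itself with carry 1, and the side is nonempty even for `x = 0`.
single : ℕ → Family
single x = ((0 , 0 , 0) , (width * (x / width) , width , (width ∸ 2) + x)) ∷ []

families : List Family
families = map fan fanData ++ map single (filter (λ x → ¬? (x ∈? usedShort)) (upTo cutoff))

open Layout width

all-good : All Good (entries families)
all-good = from-yes (all? good? (entries families))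

keys-unique : Unique (map key (entries families))
keys-unique = distinct-sound (map key (entries families)) tt

-- Shows that the families are pairwise different by comparing one number for each instead of whole
-- lists.
roots-unique : Unique (map (λ F → key (F , 0 , 1)) families)
roots-unique = distinct-sound (map (λ F → key (F , 0 , 1)) families) tt

families-nonempty : All (λ F → 1 ≤ length F) families
families-nonempty = from-yes (all? (λ F → 1 ≤? length F) families)

gain≡ : gain families ≡ 766
gain≡ = refl

totals≡ : totals families ≡ (223648 , 41216 , 275372)
totals≡ = refl

module _ (M : ℕ) where
  open Construction width families M all-good keys-unique roots-unique families-nonempty

  edges-of-design : ∀ {f : ℕ → ℕ} → (∀ n → IsMaxEdges n (f n)) →
    ∀ {n} → suc (series M M (223648 , 41216 , 275372)) ≤ n → n + M * 766 ≤ suc (f n)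
  edges-of-design = many-edges gain≡ totals≡

-- The bound and the limit

-- The coefficients are variables since literals of the size needed must not be unfolded.
quadratic : ∀ u v A B C r → let t = u * r + v in
  A * (t * t) + B * t + C ≡ A * (u * u) * (r * r) + (2 * A * u * v + B * u) * r + (A * (v * v) + B * v + C)
quadratic = solve-∀

-- Both sides are expanded as quadratics in `r` and compared coefficient by coefficient, which
-- leaves three numerical inequalities.
quadratic-≤ : ∀ u v A B C u′ v′ A′ B′ C′ r → let t = u * r + v ; t′ = u′ * r + v′ in
  A * (u * u) ≤ A′ * (u′ * u′) →
  2 * A * u * v + B * u ≤ 2 * A′ * u′ * v′ + B′ * u′ →
  A * (v * v) + B * v + C ≤ A′ * (v′ * v′) + B′ * v′ + C′ →
  A * (t * t) + B * t + C ≤ A′ * (t′ * t′) + B′ * t′ + C′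
quadratic-≤ u v A B C u′ v′ A′ B′ C′ r a b c = subst₂ _≤_ (sym (quadratic u v A B C r)) (sym (quadratic u′ v′ A′ B′ C′ r))
  (+-mono-≤ (+-mono-≤ (*-monoˡ-≤ (r * r) a) (*-monoˡ-≤ r b)) c)

-- The factors g² clear the denominator of M ≈ X / g.
enough-room : ∀ g .{{_ : NonZero g}} a b c M S X n P →
  2 * S + b * M ≡ (2 * (a * M) + b * M + 2 * c) * M → g * M ≤ X →
  2 * (2 * a + b) * (X * X) + 4 * c * g * X + 4 * (g * g) ≤ g * g * P →
  P ≤ 4 * n → suc S ≤ n
enough-room g a b c M S X n P S≡ gM≤X fits P≤ =
  *-cancelˡ-≤ 4 (*-cancelˡ-≤ (g * g) {{m*n≢0 g g}} (begin
    g * g * (4 * suc S)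
      ≡⟨ expand g S ⟩
    2 * (g * g) * (2 * S) + 4 * (g * g)
      ≤⟨ +-monoˡ-≤ (4 * (g * g)) (*-monoʳ-≤ (2 * (g * g)) (m+n≤o⇒m≤o (2 * S) (≤-reflexive S≡))) ⟩
    2 * (g * g) * ((2 * (a * M) + b * M + 2 * c) * M) + 4 * (g * g)
      ≡⟨ cong (_+ 4 * (g * g)) (regroup g a b c M) ⟩
    2 * (2 * a + b) * (g * M * (g * M)) + 4 * c * g * (g * M) + 4 * (g * g)
      ≤⟨ +-monoˡ-≤ (4 * (g * g)) (+-mono-≤ (*-monoʳ-≤ (2 * (2 * a + b)) (*-mono-≤ gM≤X gM≤X)) (*-monoʳ-≤ (4 * c * g) gM≤X)) ⟩
    2 * (2 * a + b) * (X * X) + 4 * c * g * X + 4 * (g * g)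
      ≤⟨ fits ⟩
    g * g * P
      ≤⟨ *-monoʳ-≤ (g * g) P≤ ⟩
    g * g * (4 * n) ∎))
  where
  open ≤-Reasoning
  expand : ∀ g S → g * g * (4 * suc S) ≡ 2 * (g * g) * (2 * S) + 4 * (g * g)
  expand = solve-∀
  regroup : ∀ g a b c M → 2 * (g * g) * ((2 * (a * M) + b * M + 2 * c) * M)
    ≡ 2 * (2 * a + b) * (g * M * (g * M)) + 4 * c * g * (g * M)
  regroup = solve-∀

distribute : ∀ k A B C (t : ℕ) → k * (A * (t * t) + B * t + C) ≡ k * A * (t * t) + k * B * t + k * C
distribute = solve-∀

m≤quadratic : ∀ A B C m .{{_ : NonZero B}} → m ≤ A * (m * m) + B * m + C
m≤quadratic A B C m = ≤-trans (m≤n*m m B) (≤-trans (m≤n+m (B * m) (A * (m * m))) (m≤m+n _ C))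

outgrows : ∀ k l A B C u v N K e → k * A ≤ l * (u * u) → k * (2 * A * K + B) ≤ l * (2 * u * v) →
  k * (A * (K * K) + B * K + C) ≤ l * (v * v) → u * N + v ≤ e →
  k * (A * ((N + K) * (N + K)) + B * (N + K) + C) ≤ l * (e * e)
outgrows k l A B C u v N K e a b c e≥ = ≤-trans (≤-reflexive (left k A B C N K))
  (≤-trans (+-mono-≤ (+-mono-≤ (*-monoˡ-≤ (N * N) a) (*-monoˡ-≤ N b)) c)
  (≤-trans (≤-reflexive (right l u v N)) (*-monoʳ-≤ l (*-mono-≤ e≥ e≥))))
  where
  left : ∀ k A B C N K → k * (A * ((N + K) * (N + K)) + B * (N + K) + C)
    ≡ k * A * (N * N) + k * (2 * A * K + B) * N + k * (A * (K * K) + B * K + C)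
  left = solve-∀
  right : ∀ l u v N → l * (u * u) * (N * N) + l * (2 * u * v) * N + l * (v * v) ≡ l * ((u * N + v) * (u * N + v))
  right = solve-∀

ceiling : ∀ k g → let M = (k + g) / suc g in k ≤ M * suc g × suc g * M ≤ k + g
ceiling k g = lower , ≤-trans (≤-reflexive (*-comm (suc g) M)) (m/n*n≤m (k + g) (suc g))
  where
  M = (k + g) / suc g
  lower : k ≤ M * suc g
  lower = +-cancelʳ-≤ g k (M * suc g) (begin
    k + g                          ≡⟨ m≡m%n+[m/n]*n (k + g) (suc g) ⟩
    (k + g) % suc g + M * suc g    ≤⟨ +-monoˡ-≤ (M * suc g) (≤-pred (m%n<n (k + g) (suc g))) ⟩
    g + M * suc g                  ≡⟨ +-comm g (M * suc g) ⟩
    M * suc g + g                  ∎)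
    where open ≤-Reasoning

-- Rounding the quotient of `44940 * r + 6031` by 766 up adds at most 765 to `766 * M`, which gives
-- 6796.
room : ∀ r n M S → 2 * S + 41216 * M ≡ (2 * (223648 * M) + 41216 * M + 2 * 275372) * M → 766 * M ≤ 44940 * r + 6796 →
  2119 * ((1260 * r + 169) * (1260 * r + 169)) + 351912 * (1260 * r + 169) + 15957 ≤ 4 * n → suc S ≤ n
room r n M S e upper large = enough-room 766 223648 41216 275372 M S (44940 * r + 6796) n _ e upper
        (≤-trans (quadratic-≤ 44940 6796 (2 * (2 * 223648 + 41216)) (4 * 275372 * 766) (4 * (766 * 766))
                              1260 169 (766 * 766 * 2119) (766 * 766 * 351912) (766 * 766 * 15957) r
                              (≤ᵇ⇒≤ _ _ tt) (≤ᵇ⇒≤ _ _ tt) (≤ᵇ⇒≤ _ _ tt))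
                 (≤-reflexive (sym (distribute (766 * 766) 2119 351912 15957 (1260 * r + 169)))))
        large

-- The bound on n of the theorem, which is an integer for each r.
threshold : ℕ → ℕ
threshold r = 841031100 * (r * r) + 336462210 * r + 30002461

threshold-large : ∀ r →
  2119 * ((1260 * r + 169) * (1260 * r + 169)) + 351912 * (1260 * r + 169) + 15957 ≤ 4 * threshold r
threshold-large r = ≤-trans (≤-reflexive (quadratic 1260 169 2119 351912 15957 r))
  (≤-reflexive (sym (distribute 4 841031100 336462210 30002461 r)))

threshold≥ : ∀ N → N ≤ threshold (N + 1000)
threshold≥ N = ≤-trans (m≤m+n N 1000) (m≤quadratic 841031100 336462210 30002461 (N + 1000))

-- 12100 / 5041 is the square of `slope`. The leading coefficient on the right wins by only about
-- 0.04 percent, and at `r = 0` the lower terms fail; the shift of `r` by 1000 is ample to make all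
-- coefficients in `N` compare.
threshold-steep : ∀ N e → 44940 * N + 44946030 ≤ e → 12100 * threshold (N + 1000) ≤ 5041 * (e * e)
threshold-steep N e = outgrows 12100 5041 841031100 336462210 30002461 44940 44946030 N 1000 e
  (≤ᵇ⇒≤ _ _ tt) (≤ᵇ⇒≤ _ _ tt) (≤ᵇ⇒≤ _ _ tt)

shift-excess : ∀ N → 44940 * N + 44946030 ≡ 44940 * (N + 1000) + 6030
shift-excess N = trans (sym (+-assoc (44940 * N) 44940000 6030)) (cong (_+ 6030) (sym (*-distribˡ-+ 44940 N 1000)))

surplus : ∀ {n x y} → n + x ≤ y → ∃[ e ] (y ≡ n + e × x ≤ e)
surplus {n} {x} {y} le = y ∸ n , sym (m+[n∸m]≡n (m+n≤o⇒m≤o n le)) , m+n≤o⇒m≤o∸n x (≤-trans (≤-reflexive (+-comm x n)) le)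

-- Slightly above √(12/5), but below the ratio that the design achieves.
slope : ℚ
slope = pos 110 ℚ./ 71

scaled-≤ : ∀ n e → 12100 * n ≤ 5041 * (e * e) → slope ℚ.* slope ℚ.* ℕtoℚ n ℚ.≤ (pos e ℚ./ 1) ℚ.* (pos e ℚ./ 1)
scaled-≤ n e le = ℚ.toℚᵘ-cancel-≤ (ℚᵘ.≤-trans (ℚᵘ.≤-reflexive left) (ℚᵘ.≤-trans middle (ℚᵘ.≤-reflexive (ℚᵘ.≃-sym right))))
  where
  e/1 : ℚ.toℚᵘ (pos e ℚ./ 1) ℚᵘ.≃ mkℚᵘ (pos e) 0
  e/1 = ℚ.toℚᵘ-fromℚᵘ (mkℚᵘ (pos e) 0)
  n/1 : ℚ.toℚᵘ (ℕtoℚ n) ℚᵘ.≃ mkℚᵘ (pos n) 0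
  n/1 = ℚ.toℚᵘ-fromℚᵘ (mkℚᵘ (pos n) 0)
  left : ℚ.toℚᵘ (slope ℚ.* slope ℚ.* ℕtoℚ n) ℚᵘ.≃ mkℚᵘ (pos 12100) 5040 ℚᵘ.* mkℚᵘ (pos n) 0
  left = ℚᵘ.≃-trans (ℚ.toℚᵘ-homo-* (slope ℚ.* slope) (ℕtoℚ n)) (ℚᵘ.*-congˡ {mkℚᵘ (pos 12100) 5040} n/1)
  right : ℚ.toℚᵘ ((pos e ℚ./ 1) ℚ.* (pos e ℚ./ 1)) ℚᵘ.≃ mkℚᵘ (pos e) 0 ℚᵘ.* mkℚᵘ (pos e) 0
  right = ℚᵘ.≃-trans (ℚ.toℚᵘ-homo-* (pos e ℚ./ 1) (pos e ℚ./ 1)) (ℚᵘ.*-cong e/1 e/1)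
  middle : mkℚᵘ (pos 12100) 5040 ℚᵘ.* mkℚᵘ (pos n) 0 ℚᵘ.≤ mkℚᵘ (pos e) 0 ℚᵘ.* mkℚᵘ (pos e) 0
  middle = *≤* (subst₂ ℤ._≤_
    (trans (ℤ.pos-* 12100 n) (sym (ℤ.*-identityʳ (pos 12100 ℤ.* pos n))))
    (trans (cong pos (*-comm 5041 (e * e))) (trans (ℤ.pos-* (e * e) 5041) (cong (ℤ._* pos 5041) (ℤ.pos-* e e))))
    (ℤ.+≤+ le))

dev≡ : ∀ (f : ℕ → ℕ) {n} e → f n ≡ n + e → dev f n ≡ pos e ℚ./ 1
dev≡ f {n} e fn = cong (ℚ._/ 1) (trans (cong (λ x → pos x ℤ.- pos n) fn)
  (trans (cong (ℤ._- pos n) (ℤ.+-comm (pos n) (pos e))) (trans (ℤ.+-assoc (pos e) (pos n) (ℤ.- pos n))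
    (trans (cong (λ x → pos e ℤ.+ x) (ℤ.+-inverseʳ (pos n))) (ℤ.+-identityʳ (pos e))))))

module _ {f : ℕ → ℕ} (max : ∀ n → IsMaxEdges n (f n)) where

  -- `edges-of-design` bounds `suc (f n)`, so `M` is chosen to gain one edge more than the claimed
  -- excess.
  excess : ∀ r n → 2119 * ((1260 * r + 169) * (1260 * r + 169)) + 351912 * (1260 * r + 169) + 15957 ≤ 4 * n →
    n + (44940 * r + 6030) ≤ f n
  excess r n large = ≤-pred (begin
    suc (n + (44940 * r + 6030))   ≡⟨ sym (trans (cong (n +_) (+-suc (44940 * r) 6030)) (+-suc n (44940 * r + 6030))) ⟩
    n + (44940 * r + 6031)         ≤⟨ +-monoʳ-≤ n (proj₁ M-bounds) ⟩
    n + M * 766                    ≤⟨ edges-of-design M max fits ⟩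
    suc (f n)                      ∎)
    where
    open ≤-Reasoning
    M = (44940 * r + 6031 + 765) / 766
    M-bounds = ceiling (44940 * r + 6031) 765
    fits : suc (series M M (223648 , 41216 , 275372)) ≤ n
    fits = room r n M _ (series-closed M M 223648 41216 275372)
      (≤-trans (proj₂ M-bounds) (≤-reflexive (+-assoc (44940 * r) 6031 765))) large

  lower-bound : ∀ r n → 2119 * ((1260 * r + 169) * (1260 * r + 169)) + 351912 * (1260 * r + 169) + 15957 ≤ 4 * n →
    3 * n + 107 * (1260 * r + 169) + 7 ≤ 3 * f n
  lower-bound r n large = ≤-trans (≤-reflexive (begin
      3 * n + 107 * (1260 * r + 169) + 7     ≡⟨ cong (λ x → 3 * n + x + 7) (trans (*-distribˡ-+ 107 (1260 * r) 169) (cong (_+ 107 * 169) (sym (*-assoc 107 1260 r)))) ⟩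
      3 * n + (134820 * r + 18083) + 7       ≡⟨ trans (+-assoc (3 * n) _ 7) (cong (3 * n +_) (+-assoc (134820 * r) 18083 7)) ⟩
      3 * n + (134820 * r + 18090)           ≡⟨ cong (λ x → 3 * n + (x + 18090)) (*-assoc 3 44940 r) ⟩
      3 * n + (3 * (44940 * r) + 3 * 6030)   ≡⟨ cong (3 * n +_) (sym (*-distribˡ-+ 3 (44940 * r) 6030)) ⟩
      3 * n + 3 * (44940 * r + 6030)         ≡⟨ sym (*-distribˡ-+ 3 n _) ⟩
      3 * (n + (44940 * r + 6030))           ∎))
    (*-monoʳ-≤ 3 (excess r n large))
    where open ≡-Reasoning

  steep : ∀ N → ∃[ n ] ∃[ e ] (N ≤ n × f n ≡ n + e × 12100 * n ≤ 5041 * (e * e))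
  steep N = threshold (N + 1000) , proj₁ s , threshold≥ N , proj₁ (proj₂ s) ,
    threshold-steep N (proj₁ s) (≤-trans (≤-reflexive (shift-excess N)) (proj₂ (proj₂ s)))
    where
    s : ∃[ e ] (f (threshold (N + 1000)) ≡ threshold (N + 1000) + e × 44940 * (N + 1000) + 6030 ≤ e)
    s = surplus (excess (N + 1000) (threshold (N + 1000)) (threshold-large (N + 1000)))

  too-steep : ∀ {n e} → f n ≡ n + e → 12100 * n ≤ 5041 * (e * e) → ¬ (dev f n ℚ.* dev f n ℚ.< slope ℚ.* slope ℚ.* ℕtoℚ n)
  too-steep {n} {e} fn large below = ℚ.<-irrefl refl (ℚ.<-≤-trans below
    (subst (λ d → slope ℚ.* slope ℚ.* ℕtoℚ n ℚ.≤ d ℚ.* d) (sym (dev≡ f e fn)) (scaled-≤ n e large)))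

  not-limit : ¬ LimitIsSqrt12/5 f
  -- The contradiction is with the upper bound for `q = slope`, which `steep` violates for
  -- arbitrarily large `n`.
  not-limit lim = refute (lim 1ℚ slope (from-yes (0ℚ ℚ.<? 1ℚ)) (from-yes (1ℚ ℚ.* 1ℚ ℚ.<? (pos 12 ℚ./ 5)))
    (from-yes ((pos 12 ℚ./ 5) ℚ.<? slope ℚ.* slope)) (from-yes (0ℚ ℚ.<? slope)))
    where
    Close : ℕ → Set
    Close n = (0ℚ ℚ.≤ dev f n) × (1ℚ ℚ.* 1ℚ ℚ.* ℕtoℚ n ℚ.< dev f n ℚ.* dev f n) × (dev f n ℚ.* dev f n ℚ.< slope ℚ.* slope ℚ.* ℕtoℚ n)
    refute′ : ∀ {N} → (∀ n → N ≤ n → Close n) → ¬ (∃[ n ] ∃[ e ] (N ≤ n × f n ≡ n + e × 12100 * n ≤ 5041 * (e * e)))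
    refute′ near (n , e , N≤n , fn , large) = too-steep fn large (proj₂ (proj₂ (near n N≤n)))
    refute : ¬ (∃[ N ] ∀ n → N ≤ n → Close n)
    refute (N , near) = refute′ near (steep N)

theorem7 : (f : ℕ → ℕ) → (∀ n → IsMaxEdges n (f n)) →
  ((r : ℕ) → 1 ≤ r → (n : ℕ) →
     2119 * ((1260 * r + 169) * (1260 * r + 169)) + 351912 * (1260 * r + 169) + 15957 ≤ 4 * n →
     3 * n + 107 * (1260 * r + 169) + 7 ≤ 3 * f n)
  × ¬ LimitIsSqrt12/5 f
theorem7 f max = (λ r _ n large → lower-bound max r n large) , not-limit max
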